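{- Let $\mathbf{s}=(s_1,s_2,\ldots,s_d)$ and $\mathbf{t}=(t_1,t_2,\ldots,t_e)$ be sequences of positive integers such that $\mathbf{P}_d^{(\mathbf{s})}$ is Gorenstein of index $k$ and $\mathbf{P}_e^{(\mathbf{t})}$ is Gorenstein of index $\ell$. Then $\mathbf{P}_{d+e+1}^{(\mathbf{s},1,\mathbf{t})}$ is Gorenstein of index $k+\ell$, where $(\mathbf{s},1,\mathbf{t})=(s_1,\ldots,s_d,1,t_1,\ldots,t_e)$.
   Context: For a sequence of positive integers $\mathbf{s}=(s_1,\ldots,s_d)$, the $\mathbf{s}$-lecture hall polytope is $\mathbf{P}_d^{(\mathbf{s})}=\{\mathbf{x}\in\mathbb{R}^d : 0\le \frac{x_1}{s_1}\le\frac{x_2}{s_2}\le\cdots\le\frac{x_d}{s_d}\le 1\}$, a $d$-dimensional lattice polytope. A $d$-dimensional lattice polytope $\mathcal{P}\subset\mathbb{R}^d$ is Fano if $(\mathcal{P}\setminus\partial\mathcal{P})\cap\mathbb{Z}^d=\{\mathbf{0}\}$. It is reflexive if it is Fano and its dual polytope $\mathcal{P}^\vee=\{y\in\mathbb{R}^d : \langle x,y\rangle\le 1 \text{ for all } x\in\mathcal{P}\}$ is a lattice polytope. Two $d$-dimensional lattice polytopes $\mathcal{P},\mathcal{Q}\subset\mathbb{R}^d$ are unimodularly equivalent if $\mathcal{Q}=f_U(\mathcal{P})+\mathbf{w}$ for some $U\in\mathbb{Z}^{d\times d}$ with $\det U=\pm1$ and some $\mathbf{w}\in\mathbb{Z}^d$,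 where $f_U(\mathbf{v})=\mathbf{v}U$. For $c\in\mathbb{Z}_{>0}$, $\mathcal{P}$ is Gorenstein of index $c$ if $c\mathcal{P}=\{c\alpha:\alpha\in\mathcal{P}\}$ is unimodularly equivalent to a reflexive polytope. -}

module Defs where

open import Level using (Level; _⊔_) renaming (suc to lsuc)
open import Algebra.Apartness.Structures using (IsHeytingField)
open import Algebra.Bundles using (CommutativeRing)
open import Algebra.Core using (Op₁; Op₂)
import Algebra.Properties.Semiring.Mult
import Algebra.Properties.Semiring.Sum
open import Data.Fin.Base using (Fin; zero; suc; toℕ; punchIn)
open import Data.Integer.Base as ℤ using (ℤ; 1ℤ; -1ℤ)
import Data.Integer.Properties as ℤ
open import Data.Irrelevant using ([_])
open import Data.List.Base using (_∷_; _++_; [])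
open import Data.List.Relation.Unary.Linked using (Linked)
open import Data.Nat.Base as ℕ using (ℕ; zero; suc; NonZero)
open import Data.Product.Base using (∃-syntax; _×_; _,_; proj₁)
open import Data.Refinement.Base using (Refinement-syntax; _,_)
open import Data.Sum.Base using (_⊎_; inj₂)
open import Data.Vec.Functional as Vec using (Vector)
open import Data.Vec.Functional.Relation.Binary.Pointwise using (Pointwise)
open import Function.Base using (_∘_)
open import Relation.Binary.Core using (Rel)
open import Relation.Binary.Definitions using (Cotransitive)
open import Relation.Binary.PropositionalEquality.Core using (_≡_)
open import Relation.Binary.Structures using (IsStrictPartialOrder)
open import Relation.Nullary.Negation.Core using (¬_)
open import Relation.Unary using (Pred; _∈_; _∉_; _∩_; _∖_; _≐_)

-- The real numbers, given by the axioms of a Cauchy-complete Archimedean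
-- ordered field, in the form appropriate for constructive mathematics:
-- trichotomy is replaced by cotransitivity of _<_ and tightness of the induced
-- apartness x < y ⊎ y < x.  Classically these are the usual axioms, which
-- determine ℝ up to a unique isomorphism.

record Reals (r ℓ₁ ℓ₂ : Level) : Set (lsuc (r ⊔ ℓ₁ ⊔ ℓ₂)) where
  infix  8 -_
  infixl 7 _*_
  infixl 6 _+_
  infix  4 _≈_ _<_
  field
    Carrier : Set r
    _≈_     : Rel Carrier ℓ₁
    _<_     : Rel Carrier ℓ₂
    _+_     : Op₂ Carrier
    _*_     : Op₂ Carrier
    -_      : Op₁ Carrier
    0#      : Carrier
    1#      : Carrier

    isHeytingField : IsHeytingField _≈_ (λ x y → x < y ⊎ y < x) _+_ _*_ -_ 0# 1#

  open IsHeytingField isHeytingField public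
    using (isCommutativeRing; #⇒invertible)

  commutativeRing : CommutativeRing r ℓ₁
  commutativeRing = record { isCommutativeRing = isCommutativeRing }

  open CommutativeRing commutativeRing public
    using (semiring; _-_; sym; +-identityˡ; +-identityʳ)

  open Algebra.Properties.Semiring.Mult semiring public
    using () renaming (_×_ to _×ₙ_)

  field
    <-isStrictPartialOrder : IsStrictPartialOrder _≈_ _<_
    <-cotransitive         : Cotransitive _<_
    0<1                    : 0# < 1#
    +-monoˡ-<              : ∀ {x y} z → x < y → x + z < y + z
    *-pos                  : ∀ {x y} → 0# < x → 0# < y → 0# < x * y
    archimedean            : ∀ x → ∃[ n ] x < n ×ₙ 1#
    -- m and n range independently, so this bounds |u m - u n|.
    cauchy-complete        : (u : ℕ → Carrier) →
      (∀ ε → 0# < ε → ∃[ N ] (∀ m n → N ℕ.≤ m → N ℕ.≤ n → u m - u n < ε)) →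
      ∃[ x ] (∀ ε → 0# < ε → ∃[ N ] (∀ n → N ℕ.≤ n → (u n - x < ε) × (x - u n < ε)))

ℕ⁺ : Set
ℕ⁺ = [ n ∈ ℕ ∣ NonZero n ]

1⁺ : ℕ⁺
1⁺ = 1 , [ _ ]

Matrix : ℕ → Set
Matrix n = Fin n → Fin n → ℤ

-- Laplace expansion along the first row.
det : ∀ {n} → Matrix n → ℤ
det {zero}  M = 1ℤ
det {suc n} M =
  sum (λ j → (-1ℤ ℤ.^ toℕ j) ℤ.* M zero j ℤ.* det (λ i k → M (suc i) (punchIn j k)))
  where open Algebra.Properties.Semiring.Sum ℤ.+-*-semiring using (sum)

module Polytopes {r ℓ₁ ℓ₂} (ℝ : Reals r ℓ₁ ℓ₂) where

  open Reals ℝ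
  open Algebra.Properties.Semiring.Sum semiring using (sum)

  infix  4 _≤_ _≋_
  infixl 7 _/_ _·_
  infixl 6 _⊕_

  _≤_ : Rel Carrier ℓ₂
  x ≤ y = ¬ (y < x)

  ι : ℤ → Carrier
  ι (ℤ.+ n)    = n ×ₙ 1#
  ι ℤ.-[1+ n ] = - (suc n ×ₙ 1#)

  0<n×1 : ∀ n .{{_ : NonZero n}} → 0# < n ×ₙ 1#
  0<n×1 1 = <-respʳ-≈ (sym (+-identityʳ 1#)) 0<1
    where open IsStrictPartialOrder <-isStrictPartialOrder using (<-respʳ-≈)
  0<n×1 (suc n@(suc _)) =
    <-trans (0<n×1 n) (<-respˡ-≈ (+-identityˡ _) (+-monoˡ-< (n ×ₙ 1#) 0<1))
    where open IsStrictPartialOrder <-isStrictPartialOrder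
            using (<-respˡ-≈) renaming (trans to <-trans)

  -- #⇒invertible yields an inverse of n - 0 rather than of n.
  _/_ : Carrier → ℕ⁺ → Carrier
  x / (n , [ n≢0 ]) = x * proj₁ (#⇒invertible (inj₂ (0<n×1 n {{n≢0}})))

  Point : ℕ → Set r
  Point d = Vector Carrier d

  _≋_ : ∀ {d} → Rel (Point d) ℓ₁
  _≋_ = Pointwise _≈_

  𝟎 : ∀ {d} → Point d
  𝟎 _ = 0#

  _⊕_ : ∀ {d} → Point d → Point d → Point d
  _⊕_ = Vec.zipWith _+_

  _·_ : ∀ {d} → Carrier → Point d → Point d
  a · x = Vec.map (a *_) x

  ⟨_,_⟩ : ∀ {d} → Point d → Point d → Carrier
  ⟨ x , y ⟩ = sum (Vec.zipWith _*_ x y)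

  ιᵛ : ∀ {d} → Vector ℤ d → Point d
  ιᵛ = Vec.map ι

  ℤ^ : ∀ d → Pred (Point d) ℓ₁
  ℤ^ d x = ∃[ z ] x ≋ ιᵛ z

  combination : ∀ {n d} → Vector Carrier n → Vector (Point d) n → Point d
  combination a v j = sum (λ i → a i * v i j)

  Conv : ∀ {n d} → Vector (Point d) n → Pred (Point d) (r ⊔ ℓ₁ ⊔ ℓ₂)
  Conv v x = ∃[ a ] (∀ i → 0# ≤ a i) × sum a ≈ 1# × x ≋ combination a v

  Aff : ∀ {p d} → Pred (Point d) p → Pred (Point d) (r ⊔ ℓ₁ ⊔ p)
  Aff {d = d} P x =
    ∃[ n ] ∃[ v ] ∃[ a ] (∀ (i : Fin n) → v i ∈ P) × sum a ≈ 1# × x ≋ combination a v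

  IsLatticePolytope : ∀ {p d} → Pred (Point d) p → Set (r ⊔ ℓ₁ ⊔ ℓ₂ ⊔ p)
  IsLatticePolytope {d = d} P =
    ∃[ n ] ∃[ v ] P ≐ Conv {n} {d} (Vec.map ιᵛ v)

  IsFullDimensional : ∀ {p d} → Pred (Point d) p → Set (r ⊔ ℓ₁ ⊔ p)
  IsFullDimensional P = ∀ x → x ∈ Aff P

  -- The topological boundary, with neighbourhoods taken in the sup norm.
  ∂ : ∀ {p d} → Pred (Point d) p → Pred (Point d) (r ⊔ ℓ₂ ⊔ p)
  ∂ P x = ∀ ε → 0# < ε → (∃[ y ] Near ε y × y ∈ P) × (∃[ y ] Near ε y × y ∉ P)
    where
    Near : Carrier → Pred (Point _) ℓ₂
    Near ε y = ∀ i → (x i - y i < ε) × (y i - x i < ε)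

  IsFano : ∀ {p d} → Pred (Point d) p → Set (r ⊔ ℓ₁ ⊔ ℓ₂ ⊔ p)
  IsFano {d = d} P =
    IsLatticePolytope P × IsFullDimensional P × ((P ∖ ∂ P) ∩ ℤ^ d) ≐ (_≋ 𝟎)

  Dual : ∀ {p d} → Pred (Point d) p → Pred (Point d) (r ⊔ ℓ₂ ⊔ p)
  Dual P y = ∀ x → x ∈ P → ⟨ x , y ⟩ ≤ 1#

  IsReflexive : ∀ {p d} → Pred (Point d) p → Set (r ⊔ ℓ₁ ⊔ ℓ₂ ⊔ p)
  IsReflexive P = IsFano P × IsLatticePolytope (Dual P)

  -- Row vectors: v is sent to v U.
  f[_] : ∀ {d} → Matrix d → Point d → Point d
  f[ U ] v j = sum (λ i → v i * ι (U i j))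

  image : ∀ {p d e} → (Point d → Point e) → Pred (Point d) p → Pred (Point e) (r ⊔ ℓ₁ ⊔ p)
  image g P y = ∃[ x ] x ∈ P × y ≋ g x

  UnimodularlyEquivalent : ∀ {p q d} → Pred (Point d) p → Pred (Point d) q →
                           Set (r ⊔ ℓ₁ ⊔ p ⊔ q)
  UnimodularlyEquivalent P Q =
    ∃[ U ] ∃[ w ] (det U ≡ 1ℤ ⊎ det U ≡ -1ℤ) × Q ≐ image (λ v → f[ U ] v ⊕ ιᵛ w) P

  dilate : ∀ {p d} → ℕ → Pred (Point d) p → Pred (Point d) (r ⊔ ℓ₁ ⊔ p)
  dilate c = image ((c ×ₙ 1#) ·_)

  -- The reflexive polytope Q ranges over a universe containing every set of the
  -- form U (c P) + w, so fixing that universe loses nothing.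
  IsGorensteinOfIndex : ∀ {p d} → ℕ → Pred (Point d) p → Set (lsuc (r ⊔ ℓ₁ ⊔ ℓ₂ ⊔ p))
  IsGorensteinOfIndex {p} {d} c P =
    NonZero c × IsLatticePolytope P × IsFullDimensional P ×
    ∃[ Q ] UnimodularlyEquivalent (dilate c P) Q × IsReflexive {r ⊔ ℓ₁ ⊔ ℓ₂ ⊔ p} {d} Q

  -- 0 ≤ x₁/s₁ ≤ ⋯ ≤ x_d/s_d ≤ 1.
  LectureHall : ∀ {d} → Vector ℕ⁺ d → Pred (Point d) (r ⊔ ℓ₂)
  LectureHall s x =
    Linked _≤_ (0# ∷ Vec.toList (Vec.zipWith _/_ x s) ++ 1# ∷ [])

{-# OPTIONS --safe #-}

-- Write σ₀ = σ_{d+1} = 1 and σᵢ = sᵢ.  The simplex P = P^(s) has the facet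
-- functionals βᵢ(x) = xᵢ₊₁/σᵢ₊₁ - xᵢ/σᵢ, which are also its barycentric
-- coordinates.  If U(cP) + w′ is reflexive, the preimage w of the origin is a
-- lattice point because U⁻¹ is integral, and the vertices of the dual polytope
-- are the linear parts of -βᵢ divided by the value of βᵢ at w; conversely, if
-- all these vectors are integral, cP - w is reflexive.  In integers, with
-- w₀ = 0 and w_{d+1} = c, the condition says that
--   hᵢ = σᵢ wᵢ₊₁ - σᵢ₊₁ wᵢ  is positive and divides both σᵢ and σᵢ₊₁,
-- so that it is a condition on the steps of the path (1,0), (s₁,w₁), …, (1,c).
-- The shear (σ,a) ↦ (σ, a + kσ) preserves every hᵢ; it moves the path of t so
-- that it starts at (1,k), where the path of s ends, and gluing the two paths
-- gives a path for (s,1,t) from (1,0) to (1,k+l).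
module Submission where

open import Defs
open import Level using (Level; _⊔_)
open import Algebra.Apartness.Structures using (IsHeytingField)
open import Algebra.Bundles using (CommutativeRing)
import Algebra.Properties.Ring
import Algebra.Properties.Semiring.Mult
import Algebra.Properties.Semiring.Sum
import Algebra.Solver.Ring
open import Algebra.Solver.Ring.AlmostCommutativeRing using (fromCommutativeRing; _-Raw-AlmostCommutative⟶_)
open import Data.Fin.Base using (Fin; zero; suc; toℕ; punchIn; splitAt)
open import Data.Fin.Properties using (_≟_; suc-injective)
open import Data.Integer.Base as ℤ using (ℤ; +_; -[1+_]; 0ℤ; 1ℤ; -1ℤ; _⊖_)
open import Data.Integer.Divisibility.Signed using (_∣_; divides; quotient; ∣-trans; ∣m∣n⇒∣m-n; ∣m⇒∣m*n)
import Data.Integer.Properties as ℤ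
open import Data.Integer.Tactic.RingSolver using (solve-∀)
open import Data.Irrelevant using ([_])
import Data.List.Base as List
import Data.List.Properties as List
open import Data.List.Relation.Unary.Linked as Linked using (Linked; [-]) renaming (_∷_ to infixr 5 _∷ᴸ_)
import Data.List.Relation.Unary.Linked.Properties as Linked
open import Data.Maybe.Base using (just; nothing)
open import Data.Nat.Base as ℕ using (ℕ; zero; suc; NonZero)
import Data.Nat.Properties as ℕ
open import Data.Product.Base using (∃-syntax; _×_; _,_; proj₁; proj₂)
open import Data.Refinement.Base using (value; _,_)
open import Data.Sum.Base as Sum using (_⊎_; inj₁; inj₂)
open import Data.Vec.Functional as Vec using (Vector; _∷_; _++_; updateAt)
open import Data.Vec.Functional.Properties using (updateAt-updates; updateAt-minimal)
open import Function.Base using (_∘_; const)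
open import Relation.Binary.Definitions using (WeaklyDecidable; tri<; tri≈; tri>)
open import Relation.Binary.PropositionalEquality as ≡ using (_≡_; _≢_; cong; cong₂)
open import Relation.Binary.Structures using (IsStrictPartialOrder)
open import Relation.Nullary.Decidable using (yes; no)
open import Relation.Nullary.Negation using (¬_; contradiction)
open import Relation.Unary using (Pred; _∈_; _∉_; _≐_)

-- Multiplying by σᵢσᵢ₊₁ turns the linear part of βᵢ into σᵢyᵢ₊₁ - σᵢ₊₁yᵢ and the value at w into
-- hᵢ, so integrality of the quotient means that hᵢ divides both coefficients. At either end of the
-- path one of the two heights is fixed, and the free one has coefficient 1; there hᵢ divides 1 and
-- hence the other coefficient too. This needs d ≥ 1: for d = 0 no height is free, and integrality
-- says nothing about c. Two obstacles shape the rest. The order of the reals is not decidable;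
-- signs of facet functionals are decided only at lattice points, where the same scaling makes them
-- integers. And the dual polytope is given as the hull of finitely many lattice points, without any
-- notion of vertex; the vertex wanted is found as a generator of positive weight in a suitable
-- convex combination.

-- Linear forms over a commutative ring.

module LinearForm {c ℓ : Level} (R : CommutativeRing c ℓ) where
  open CommutativeRing R hiding (zero)
  open Algebra.Properties.Semiring.Sum semiring
  open import Relation.Binary.Reasoning.Setoid setoid

  e : ∀ {n} → Fin n → Vector Carrier n
  e zero    = 1# ∷ const 0#
  e (suc i) = 0# ∷ e i

  -- The hypothesis compares vectors entrywise up to `≈`, so that compatibility of `φ` with
  -- pointwise equality is a consequence and not a separate requirement.
  IsLinear : ∀ {n} → (Vector Carrier n → Carrier) → Set (c ⊔ ℓ)
  IsLinear φ = ∀ a b {x y z} → (∀ j → x j ≈ a * y j + b * z j) → φ x ≈ a * φ y + b * φ z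

  sum-zero : ∀ {n} {x : Vector Carrier n} → (∀ j → x j ≈ 0#) → sum x ≈ 0#
  sum-zero {n} x≈0 = trans (sum-cong-≋ x≈0) (sum-replicate-zero n)

  linear-expansion : ∀ {n} {φ : Vector Carrier n → Carrier} → IsLinear φ →
                     ∀ x → φ x ≈ sum (λ j → x j * φ (e j))
  linear-expansion {zero} {φ} lin x = begin
    φ x                    ≈⟨ lin 0# 0# {y = x} {z = x} (λ ()) ⟩
    0# * φ x + 0# * φ x    ≈⟨ +-cong (zeroˡ _) (zeroˡ _) ⟩
    0# + 0#                ≈⟨ +-identityˡ 0# ⟩
    0#                     ∎
  linear-expansion {suc n} {φ} lin x = begin
    φ x                                    ≈⟨ lin (x zero) 1# split ⟩
    x zero * φ (e zero) + 1# * φ (0# ∷ x ∘ suc)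
      ≈⟨ +-congˡ (trans (*-identityˡ _) (linear-expansion lin′ (x ∘ suc))) ⟩
    x zero * φ (e zero) + sum (λ j → x (suc j) * φ (e (suc j)))  ∎
    where
    split : ∀ j → x j ≈ x zero * e zero j + 1# * (0# ∷ x ∘ suc) j
    split zero    = sym (trans (+-cong (*-identityʳ _) (zeroʳ _)) (+-identityʳ _))
    split (suc j) = sym (trans (+-cong (zeroʳ _) (*-identityˡ _)) (+-identityˡ _))
    lin′ : IsLinear (λ y → φ (0# ∷ y))
    lin′ a b {x′} {y} {z} h = lin a b h′
      where
      h′ : ∀ j → (0# ∷ x′) j ≈ a * (0# ∷ y) j + b * (0# ∷ z) j
      h′ zero    = sym (trans (+-cong (zeroʳ _) (zeroʳ _)) (+-identityʳ _))
      h′ (suc j) = h j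

-- Determinants and the integral inverse of a unimodular matrix.

module Determinant where
  open Algebra.Properties.Semiring.Sum ℤ.+-*-semiring public
  open LinearForm ℤ.+-*-commutativeRing public
  open ≡.≡-Reasoning

  private
    minor : ∀ {n} → Matrix (suc n) → Fin (suc n) → Matrix n
    minor M j i k = M (suc i) (punchIn j k)

  det-cong : ∀ {n} {A B : Matrix n} → (∀ i j → A i j ≡ B i j) → det A ≡ det B
  det-cong {zero}  A≡B = ≡.refl
  det-cong {suc n} A≡B = sum-cong-≋ λ j →
    cong₂ ℤ._*_ (cong (-1ℤ ℤ.^ toℕ j ℤ.*_) (A≡B zero j))
                (det-cong λ i k → A≡B (suc i) (punchIn j k))

  -- In the expansion along row 0, either `k` is that row and only the coefficients vary, or the
  -- coefficients agree and the minors are linear by induction.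
  det-linear : ∀ {n} {A B C : Matrix n} k a b →
               (∀ i → i ≢ k → ∀ j → A i j ≡ B i j) → (∀ i → i ≢ k → ∀ j → A i j ≡ C i j) →
               (∀ j → A k j ≡ a ℤ.* B k j ℤ.+ b ℤ.* C k j) → det A ≡ a ℤ.* det B ℤ.+ b ℤ.* det C
  det-linear {suc n} {A} {B} {C} k a b A≡B A≡C Aₖ = begin
    det A                                             ≡⟨ sum-cong-≋ (term k A≡B A≡C Aₖ) ⟩
    sum (λ j → a ℤ.* β j ℤ.+ b ℤ.* γ j)               ≡⟨ ∑-distrib-+ (λ j → a ℤ.* β j) (λ j → b ℤ.* γ j) ⟩
    sum (λ j → a ℤ.* β j) ℤ.+ sum (λ j → b ℤ.* γ j)
      ≡⟨ cong₂ ℤ._+_ (*-distribˡ-sum a β) (*-distribˡ-sum b γ) ⟨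
    a ℤ.* det B ℤ.+ b ℤ.* det C                       ∎
    where
    β γ : Vector ℤ (suc n)
    β j = (-1ℤ ℤ.^ toℕ j) ℤ.* B zero j ℤ.* det (minor B j)
    γ j = (-1ℤ ℤ.^ toℕ j) ℤ.* C zero j ℤ.* det (minor C j)
    term : ∀ k → (∀ i → i ≢ k → ∀ j → A i j ≡ B i j) → (∀ i → i ≢ k → ∀ j → A i j ≡ C i j) →
           (∀ j → A k j ≡ a ℤ.* B k j ℤ.+ b ℤ.* C k j) →
           ∀ j → (-1ℤ ℤ.^ toℕ j) ℤ.* A zero j ℤ.* det (minor A j) ≡ a ℤ.* β j ℤ.+ b ℤ.* γ j
    term zero A≡B A≡C Aₖ j
      rewrite Aₖ j
            | ≡.sym (det-cong {A = minor A j} {minor B j} λ i k → A≡B (suc i) (λ ()) (punchIn j k))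
            | ≡.sym (det-cong {A = minor A j} {minor C j} λ i k → A≡C (suc i) (λ ()) (punchIn j k))
      = lemma (-1ℤ ℤ.^ toℕ j) a b (B zero j) (C zero j) (det (minor A j))
      where
      lemma : ∀ s a b x y m → s ℤ.* (a ℤ.* x ℤ.+ b ℤ.* y) ℤ.* m ≡
                              a ℤ.* (s ℤ.* x ℤ.* m) ℤ.+ b ℤ.* (s ℤ.* y ℤ.* m)
      lemma = solve-∀
    term (suc k) A≡B A≡C Aₖ j
      rewrite det-linear {A = minor A j} {minor B j} {minor C j} k a b
                (λ i i≢k l → A≡B (suc i) (i≢k ∘ suc-injective) (punchIn j l))
                (λ i i≢k l → A≡C (suc i) (i≢k ∘ suc-injective) (punchIn j l))
                (λ l → Aₖ (punchIn j l))
            | ≡.sym (A≡B zero (λ ()) j) | ≡.sym (A≡C zero (λ ()) j)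
      = lemma (-1ℤ ℤ.^ toℕ j) a b (A zero j) (det (minor B j)) (det (minor C j))
      where
      lemma : ∀ s a b x p q → s ℤ.* x ℤ.* (a ℤ.* p ℤ.+ b ℤ.* q) ≡
                              a ℤ.* (s ℤ.* x ℤ.* p) ℤ.+ b ℤ.* (s ℤ.* x ℤ.* q)
      lemma = solve-∀

  -- Deleting the columns j and punchIn j k in either order leaves the same
  -- columns, so the terms of the double expansion cancel in pairs.
  private
    double-expansion : ∀ {n} (x : Vector ℤ (suc (suc n))) (D : (Fin n → Fin (suc (suc n))) → ℤ) →
      (∀ {f g} → (∀ c → f c ≡ g c) → D f ≡ D g) →
      sum (λ j → sum (λ k → (-1ℤ ℤ.^ toℕ j ℤ.* x j) ℤ.* (-1ℤ ℤ.^ toℕ k ℤ.* x (punchIn j k) ℤ.*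
                            D (punchIn j ∘ punchIn k)))) ≡ 0ℤ
    double-expansion {zero} x D D-cong = begin
      T zero zero ℤ.+ 0ℤ ℤ.+ (T (suc zero) zero ℤ.+ 0ℤ ℤ.+ 0ℤ)
        ≡⟨ cong (λ z → T zero zero ℤ.+ 0ℤ ℤ.+ (-1ℤ ℤ.* 1ℤ ℤ.* x (suc zero) ℤ.* (1ℤ ℤ.* x zero ℤ.* z) ℤ.+ 0ℤ ℤ.+ 0ℤ))
                (D-cong (λ ())) ⟩
      _ ≡⟨ lemma (x zero) (x (suc zero)) (D (λ c → suc (suc c))) ⟩
      0ℤ ∎
      where
      T : Fin 2 → Fin 1 → ℤ
      T j k = (-1ℤ ℤ.^ toℕ j ℤ.* x j) ℤ.* (-1ℤ ℤ.^ toℕ k ℤ.* x (punchIn j k) ℤ.* D (punchIn j ∘ punchIn k))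
      lemma : ∀ a b d → (1ℤ ℤ.* a) ℤ.* (1ℤ ℤ.* b ℤ.* d) ℤ.+ 0ℤ ℤ.+
                        (-1ℤ ℤ.* 1ℤ ℤ.* b ℤ.* (1ℤ ℤ.* a ℤ.* d) ℤ.+ 0ℤ ℤ.+ 0ℤ) ≡ 0ℤ
      lemma = solve-∀
    double-expansion {suc n} x D D-cong = begin
      row ℤ.+ sum (λ j → T (suc j) zero ℤ.+ sum (λ k → T (suc j) (suc k)))
        ≡⟨ cong (λ z → row ℤ.+ z)
             (∑-distrib-+ (λ j → T (suc j) zero) (λ j → sum (λ k → T (suc j) (suc k)))) ⟩
      -- The terms with j = 0 will cancel against those with k = 0. Where both indices are
      -- successors the two extra signs cancel, which leaves the same double sum for `x ∘ suc`.
      row ℤ.+ (column ℤ.+ sum (λ j → sum (λ k → T (suc j) (suc k))))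
        ≡⟨ cong (λ z → row ℤ.+ (column ℤ.+ z)) (≡.trans (sum-cong-≋ λ j → sum-cong-≋ λ k → shift j k)
             (double-expansion (x ∘ suc) D′ D′-cong)) ⟩
      row ℤ.+ (column ℤ.+ 0ℤ)  ≡⟨ cong (λ z → row ℤ.+ z) (ℤ.+-identityʳ column) ⟩
      row ℤ.+ column           ≡⟨ ∑-distrib-+ (λ k → T zero k) (λ k → T (suc k) zero) ⟨
      sum (λ k → T zero k ℤ.+ T (suc k) zero)  ≡⟨ sum-zero cancel ⟩
      0ℤ ∎
      where
      T : Fin (suc (suc (suc n))) → Fin (suc (suc n)) → ℤ
      T j k = (-1ℤ ℤ.^ toℕ j ℤ.* x j) ℤ.* (-1ℤ ℤ.^ toℕ k ℤ.* x (punchIn j k) ℤ.* D (punchIn j ∘ punchIn k))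
      row column : ℤ
      row    = sum (λ k → T zero k)
      column = sum (λ j → T (suc j) zero)
      lift : (Fin n → Fin (suc (suc n))) → Fin (suc n) → Fin (suc (suc (suc n)))
      lift f zero    = zero
      lift f (suc c) = suc (f c)
      D′ : (Fin n → Fin (suc (suc n))) → ℤ
      D′ f = D (lift f)
      D′-cong : ∀ {f g} → (∀ c → f c ≡ g c) → D′ f ≡ D′ g
      D′-cong f≡g = D-cong λ where
        zero    → ≡.refl
        (suc c) → cong suc (f≡g c)
      shift : ∀ j k → T (suc j) (suc k) ≡
              (-1ℤ ℤ.^ toℕ j ℤ.* x (suc j)) ℤ.* (-1ℤ ℤ.^ toℕ k ℤ.* x (suc (punchIn j k)) ℤ.* D′ (punchIn j ∘ punchIn k))
      shift j k = ≡.trans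
        (cong (λ z → (-1ℤ ℤ.* -1ℤ ℤ.^ toℕ j ℤ.* x (suc j)) ℤ.* (-1ℤ ℤ.* -1ℤ ℤ.^ toℕ k ℤ.* x (suc (punchIn j k)) ℤ.* z))
          (D-cong λ where
            zero    → ≡.refl
            (suc c) → ≡.refl))
        (lemma (-1ℤ ℤ.^ toℕ j) (x (suc j)) (-1ℤ ℤ.^ toℕ k) (x (suc (punchIn j k))) (D′ (punchIn j ∘ punchIn k)))
        where
        lemma : ∀ s a t b d → (-1ℤ ℤ.* s ℤ.* a) ℤ.* (-1ℤ ℤ.* t ℤ.* b ℤ.* d) ≡ (s ℤ.* a) ℤ.* (t ℤ.* b ℤ.* d)
        lemma = solve-∀
      cancel : ∀ k → T zero k ℤ.+ T (suc k) zero ≡ 0ℤ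
      cancel k = ≡.trans
        (cong (λ z → T zero k ℤ.+ (-1ℤ ℤ.* -1ℤ ℤ.^ toℕ k ℤ.* x (suc k)) ℤ.* (1ℤ ℤ.* x zero ℤ.* z))
          (D-cong λ c → ≡.refl))
        (lemma (-1ℤ ℤ.^ toℕ k) (x zero) (x (suc k)) (D (suc ∘ punchIn k)))
        where
        lemma : ∀ s a b d → (1ℤ ℤ.* a) ℤ.* (s ℤ.* b ℤ.* d) ℤ.+ (-1ℤ ℤ.* s ℤ.* b) ℤ.* (1ℤ ℤ.* a ℤ.* d) ≡ 0ℤ
        lemma = solve-∀

    -- Expanding along rows 0 and 1 gives products of two entries of one and the same vector, the
    -- situation of `double-expansion`.
    det-alternating₀₁ : ∀ {n} (M : Matrix (suc (suc n))) → (∀ j → M zero j ≡ M (suc zero) j) → det M ≡ 0ℤ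
    det-alternating₀₁ {n} M M₀≡M₁ = ≡.trans
      (sum-cong-≋ λ j → ≡.trans
        (*-distribˡ-sum (-1ℤ ℤ.^ toℕ j ℤ.* M zero j) (λ k → -1ℤ ℤ.^ toℕ k ℤ.* M (suc zero) (punchIn j k) ℤ.*
           det (λ i l → M (suc (suc i)) (punchIn j (punchIn k l)))))
        (sum-cong-≋ λ k → cong (λ z → (-1ℤ ℤ.^ toℕ j ℤ.* M zero j) ℤ.* (-1ℤ ℤ.^ toℕ k ℤ.* z ℤ.*
                              det (λ i l → M (suc (suc i)) (punchIn j (punchIn k l)))))
                            (≡.sym (M₀≡M₁ (punchIn j k)))))
      (double-expansion (M zero) (λ f → det (λ i l → M (suc (suc i)) (f l)))
        (λ f≡g → det-cong λ i l → cong (M (suc (suc i))) (f≡g l)))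

  Alternating : ℕ → Set
  Alternating n = ∀ (M : Matrix n) i j → i ≢ j → (∀ k → M i k ≡ M j k) → det M ≡ 0ℤ

  private
    first-row-repeated : ∀ {n} → Alternating n → ∀ (M : Matrix (suc n)) b →
                         (∀ k → M zero k ≡ M (suc b) k) → det M ≡ 0ℤ
    first-row-repeated minors-alternating M zero M₀≡M₁ = det-alternating₀₁ M M₀≡M₁
    -- Polarisation in the rows 1 and b, with row 0 equal to row b.
    first-row-repeated {suc n} minors-alternating M (suc b′) M₀≡M_b = begin
      det M                                ≡⟨ det-cong M≡N ⟩
      det (N r x)                          ≡⟨ ℤ.+-identityʳ _ ⟨
      -- Adding `r` to row b changes nothing, because `N r r` repeats a row; the matrix added has
      -- both rows 0 and 1 equal to `x`.
      det (N r x) ℤ.+ 0ℤ                   ≡⟨ cong₂ ℤ._+_ drop-repeat N-x ⟨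
      det (N r r+x) ℤ.+ det (N x r+x)      ≡⟨ first r+x ⟨
      det (N r+x r+x)                      ≡⟨ repeat r+x ⟩
      0ℤ                                   ∎
      where
      b : Fin (suc n)
      b = suc b′
      1F : Fin (suc (suc n))
      1F = suc zero
      suc² : Fin n → Fin (suc (suc n))
      suc² i = suc (suc i)
      x r r+x : Vector ℤ (suc (suc n))
      x = M zero
      r = M 1F
      r+x k = 1ℤ ℤ.* r k ℤ.+ 1ℤ ℤ.* x k
      N : Vector ℤ (suc (suc n)) → Vector ℤ (suc (suc n)) → Matrix (suc (suc n))
      N p q zero           = x
      N p q (suc zero)     = p
      N p q (suc (suc i))  = updateAt (λ i → M (suc (suc i))) b′ (const q) i
      N-b : ∀ p q k → N p q (suc b) k ≡ q k
      N-b p q k = cong (λ f → f k) (updateAt-updates b′ (λ i → M (suc (suc i))))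
      M≡N : ∀ i k → M i k ≡ N r x i k
      M≡N zero k = ≡.refl
      M≡N (suc zero) k = ≡.refl
      M≡N (suc (suc i)) k with i ≟ b′
      ... | yes ≡.refl = ≡.trans (≡.sym (M₀≡M_b k)) (≡.sym (N-b r x k))
      ... | no  i≢b′ = ≡.sym (cong (λ f → f k) (updateAt-minimal i b′ (λ i → M (suc (suc i))) i≢b′))
      unit : ∀ {a} c d → a ≡ 1ℤ ℤ.* c ℤ.+ 1ℤ ℤ.* d → a ≡ c ℤ.+ d
      unit c d h = ≡.trans h (cong₂ ℤ._+_ (ℤ.*-identityˡ c) (ℤ.*-identityˡ d))
      first : ∀ q → det (N r+x q) ≡ det (N r q) ℤ.+ det (N x q)
      first q = unit (det (N r q)) (det (N x q)) (det-linear 1F 1ℤ 1ℤ (same r) (same x) (λ _ → ≡.refl))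
        where
        same : ∀ p i → i ≢ 1F → ∀ k → N r+x q i k ≡ N p q i k
        same p zero          _   _ = ≡.refl
        same p (suc zero)    i≢1 _ = contradiction ≡.refl i≢1
        same p (suc (suc i)) _   _ = ≡.refl
      second : ∀ p → det (N p r+x) ≡ det (N p r) ℤ.+ det (N p x)
      second p = unit (det (N p r)) (det (N p x)) (det-linear (suc b) 1ℤ 1ℤ (same r) (same x)
        (λ k → ≡.trans (N-b p r+x k) (≡.sym (cong₂ (λ y z → 1ℤ ℤ.* y ℤ.+ 1ℤ ℤ.* z) (N-b p r k) (N-b p x k)))))
        where
        same : ∀ q i → i ≢ suc b → ∀ k → N p r+x i k ≡ N p q i k
        same q zero          _   _ = ≡.refl
        same q (suc zero)    _   _ = ≡.refl
        same q (suc (suc i)) i≢b k = cong (λ f → f k) (≡.trans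
          (updateAt-minimal i b′ (λ i → M (suc (suc i))) (i≢b ∘ cong suc²))
          (≡.sym (updateAt-minimal i b′ (λ i → M (suc (suc i))) (i≢b ∘ cong suc²))))
      -- Rows 1 and b survive in every minor along row 0, so the induction hypothesis applies to
      -- each minor.
      repeat : ∀ p → det (N p p) ≡ 0ℤ
      repeat p = sum-zero λ k → ≡.trans
        (cong (-1ℤ ℤ.^ toℕ k ℤ.* x k ℤ.*_)
          (minors-alternating (minor (N p p) k) zero b (λ ()) (λ l → ≡.sym (N-b p p (punchIn k l)))))
        (ℤ.*-zeroʳ (-1ℤ ℤ.^ toℕ k ℤ.* x k))
      drop-repeat : det (N r r+x) ≡ det (N r x)
      drop-repeat = ≡.trans (second r) (≡.trans (cong (ℤ._+ det (N r x)) (repeat r)) (ℤ.+-identityˡ _))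
      N-x : det (N x r+x) ≡ 0ℤ
      N-x = det-alternating₀₁ (N x r+x) (λ _ → ≡.refl)

  det-alternating : ∀ {n} → Alternating n
  det-alternating         M zero    zero    i≢j _     = contradiction ≡.refl i≢j
  det-alternating         M zero    (suc j) _   Mᵢ≡Mⱼ = first-row-repeated det-alternating M j Mᵢ≡Mⱼ
  det-alternating         M (suc i) zero    _   Mᵢ≡Mⱼ = first-row-repeated det-alternating M i (≡.sym ∘ Mᵢ≡Mⱼ)
  det-alternating {suc n} M (suc i) (suc j) i≢j Mᵢ≡Mⱼ = sum-zero λ k → ≡.trans
    (cong (-1ℤ ℤ.^ toℕ k ℤ.* M zero k ℤ.*_)
      (det-alternating (minor M k) i j (i≢j ∘ cong suc) (λ l → Mᵢ≡Mⱼ (punchIn k l))))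
    (ℤ.*-zeroʳ (-1ℤ ℤ.^ toℕ k ℤ.* M zero k))

  det-e : ∀ {n} → det (e {n}) ≡ 1ℤ
  det-e {zero}  = ≡.refl
  det-e {suc n} = cong₂ ℤ._+_
    (≡.trans (ℤ.*-identityˡ _) (det-e {n}))
    (sum-zero {n} λ j → cong (ℤ._* det (minor e (suc j))) (ℤ.*-zeroʳ (-1ℤ ℤ.^ toℕ (suc j))))

  e-diagonal : ∀ {n} (i : Fin n) → e i i ≡ 1ℤ
  e-diagonal zero    = ≡.refl
  e-diagonal (suc i) = e-diagonal i

  e-off-diagonal : ∀ {n} {i j : Fin n} → i ≢ j → e i j ≡ 0ℤ
  e-off-diagonal {i = zero}  {zero}  i≢j = contradiction ≡.refl i≢j
  e-off-diagonal {i = zero}  {suc j} i≢j = ≡.refl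
  e-off-diagonal {i = suc i} {zero}  i≢j = ≡.refl
  e-off-diagonal {i = suc i} {suc j} i≢j = e-off-diagonal (i≢j ∘ cong suc)

  -- Cramer's rule: column k of the inverse is given by the linear form
  -- x ↦ det U · det (U with row k replaced by x).
  unimodular-inverse : ∀ {n} (U : Matrix n) → det U ≡ 1ℤ ⊎ det U ≡ -1ℤ →
                       ∃[ V ] (∀ i k → sum (λ j → U i j ℤ.* V j k) ≡ e i k)
  unimodular-inverse {n} U det≡±1 = (λ j k → det U ℤ.* φ k (e j)) , λ i k → begin
    sum (λ j → U i j ℤ.* (det U ℤ.* φ k (e j)))   ≡⟨ sum-cong-≋ (λ j → lemma (U i j) (det U) (φ k (e j))) ⟩
    sum (λ j → det U ℤ.* (U i j ℤ.* φ k (e j)))   ≡⟨ *-distribˡ-sum (det U) (λ j → U i j ℤ.* φ k (e j)) ⟨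
    det U ℤ.* sum (λ j → U i j ℤ.* φ k (e j))     ≡⟨ cong (det U ℤ.*_) (linear-expansion (φ-linear k) (U i)) ⟨
    det U ℤ.* φ k (U i)                           ≡⟨ entry i k ⟩
    e i k                                         ∎
    where
    φ : Fin n → Vector ℤ n → ℤ
    φ k x = det (updateAt U k (const x))
    same : ∀ {k i} → i ≢ k → ∀ {x} → updateAt U k (const x) i ≡ U i
    same {k} {i} i≢k = updateAt-minimal i k U i≢k
    φ-linear : ∀ k → IsLinear (φ k)
    φ-linear k a b {x} {y} {z} h = det-linear k a b
      (λ i i≢k j → cong (λ f → f j) (≡.trans (same i≢k) (≡.sym (same i≢k))))
      (λ i i≢k j → cong (λ f → f j) (≡.trans (same i≢k) (≡.sym (same i≢k))))
      λ j → ≡.trans (cong (λ f → f j) (updateAt-updates k U)) (≡.trans (h j)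
        (≡.sym (cong₂ (λ p q → a ℤ.* p ℤ.+ b ℤ.* q) (cong (λ f → f j) (updateAt-updates k U))
                                                   (cong (λ f → f j) (updateAt-updates k U)))))
    lemma : ∀ u d x → u ℤ.* (d ℤ.* x) ≡ d ℤ.* (u ℤ.* x)
    lemma = solve-∀
    -- Being ±1, `det U` is its own inverse; multiplying by it replaces the division in Cramer's
    -- rule.
    square : det U ℤ.* det U ≡ 1ℤ
    square = Sum.[ (λ p → cong₂ ℤ._*_ p p) , (λ p → cong₂ ℤ._*_ p p) ]′ det≡±1
    entry : ∀ i k → det U ℤ.* φ k (U i) ≡ e i k
    entry i k with i ≟ k
    ... | yes ≡.refl = ≡.trans (cong (det U ℤ.*_) (det-cong unchanged))
                             (≡.trans square (≡.sym (e-diagonal i)))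
      where
      unchanged : ∀ l j → updateAt U i (const (U i)) l j ≡ U l j
      unchanged l j with l ≟ i
      ... | yes ≡.refl = cong (λ f → f j) (updateAt-updates i U)
      ... | no  l≢i  = cong (λ f → f j) (same l≢i)
    ... | no  i≢k  = ≡.trans (cong (det U ℤ.*_) (det-alternating _ i k i≢k λ j →
        ≡.trans (cong (λ f → f j) (same i≢k)) (cong (λ f → f j) (≡.sym (updateAt-updates k U)))))
      (≡.trans (ℤ.*-zeroʳ (det U)) (≡.sym (e-off-diagonal i≢k)))

-- Ordered field arithmetic of the constructive reals and the embedded integers.

module RealAlgebra {r ℓ₁ ℓ₂ : Level} (ℝ : Reals r ℓ₁ ℓ₂) where
  open Reals ℝ public hiding (sym; +-identityˡ; +-identityʳ)
  open CommutativeRing commutativeRing public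
    hiding (Carrier; _≈_; _+_; _*_; -_; 0#; 1#; _-_; semiring; isCommutativeRing; zero)
  open Polytopes ℝ public
  open LinearForm commutativeRing public
  open Algebra.Properties.Semiring.Sum semiring public
  open Algebra.Properties.Semiring.Mult semiring using (×-homo-+; ×1-homo-*)
  open Algebra.Properties.Ring ring public using (-0#≈0#; -‿involutive; -‿+-comm; -‿distribˡ-*; -‿distribʳ-*)
  open IsHeytingField isHeytingField using (tight; invertible⇒#)
  open IsStrictPartialOrder <-isStrictPartialOrder public
    using (<-respʳ-≈; <-respˡ-≈) renaming (trans to <-trans; irrefl to <-irrefl)
  open import Relation.Binary.Reasoning.Setoid setoid public

  private
    ι-⊖ : ∀ m n → ι (m ⊖ n) ≈ m ×ₙ 1# - n ×ₙ 1#
    ι-⊖ m       zero    = sym (trans (+-congˡ -0#≈0#) (+-identityʳ _))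
    ι-⊖ zero    (suc n) = sym (+-identityˡ _)
    ι-⊖ (suc m) (suc n) = begin
      ι (suc m ⊖ suc n)                          ≡⟨ cong ι (ℤ.[1+m]⊖[1+n]≡m⊖n m n) ⟩
      ι (m ⊖ n)                                  ≈⟨ ι-⊖ m n ⟩
      m ×ₙ 1# - n ×ₙ 1#                          ≈⟨ +-congʳ (+-identityʳ _) ⟨
      m ×ₙ 1# + 0# - n ×ₙ 1#                     ≈⟨ +-congʳ (+-congˡ (-‿inverseʳ 1#)) ⟨
      m ×ₙ 1# + (1# - 1#) - n ×ₙ 1#              ≈⟨ +-congʳ (+-assoc _ _ _) ⟨
      m ×ₙ 1# + 1# - 1# - n ×ₙ 1#                ≈⟨ +-congʳ (+-congʳ (+-comm _ _)) ⟩
      1# + m ×ₙ 1# - 1# - n ×ₙ 1#                ≈⟨ +-assoc _ _ _ ⟩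
      1# + m ×ₙ 1# + (- 1# - n ×ₙ 1#)            ≈⟨ +-congˡ (-‿+-comm _ _) ⟩
      1# + m ×ₙ 1# - (1# + n ×ₙ 1#)              ∎

  ι-+ : ∀ i j → ι (i ℤ.+ j) ≈ ι i + ι j
  ι-+ (+ m)    (+ n)    = ×-homo-+ 1# m n
  ι-+ (+ m)    -[1+ n ] = ι-⊖ m (suc n)
  ι-+ -[1+ m ] (+ n)    = trans (ι-⊖ n (suc m)) (+-comm _ _)
  ι-+ -[1+ m ] -[1+ n ] = trans
    (-‿cong (trans (reflexive (cong (λ k → suc k ×ₙ 1#) (≡.sym (ℕ.+-suc m n)))) (×-homo-+ 1# (suc m) (suc n))))
    (sym (-‿+-comm _ _))

  ι-neg : ∀ i → ι (ℤ.- i) ≈ - ι i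
  ι-neg (+ zero)  = sym -0#≈0#
  ι-neg (+ suc n) = refl
  ι-neg -[1+ n ]  = sym (-‿involutive _)

  ι-* : ∀ i j → ι (i ℤ.* j) ≈ ι i * ι j
  ι-* (+ m) j = ι-+* m j
    where
    ι-+* : ∀ m j → ι (+ m ℤ.* j) ≈ m ×ₙ 1# * ι j
    ι-+* m (+ n) = trans (reflexive (cong ι (≡.sym (ℤ.pos-* m n)))) (×1-homo-* m n)
    ι-+* m -[1+ n ] = begin
      ι (+ m ℤ.* (ℤ.- (+ suc n)))   ≡⟨ cong ι (ℤ.neg-distribʳ-* (+ m) (+ suc n)) ⟨
      ι (ℤ.- (+ m ℤ.* (+ suc n)))   ≈⟨ ι-neg (+ m ℤ.* (+ suc n)) ⟩
      - ι (+ m ℤ.* (+ suc n))       ≈⟨ -‿cong (ι-+* m (+ suc n)) ⟩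
      - (m ×ₙ 1# * ι (+ suc n))     ≈⟨ -‿distribʳ-* _ _ ⟩
      m ×ₙ 1# * ι -[1+ n ]          ∎
  ι-* -[1+ m ] j = begin
    ι ((ℤ.- (+ suc m)) ℤ.* j)   ≡⟨ cong ι (ℤ.neg-distribˡ-* (+ suc m) j) ⟨
    ι (ℤ.- ((+ suc m) ℤ.* j))   ≈⟨ ι-neg ((+ suc m) ℤ.* j) ⟩
    - ι ((+ suc m) ℤ.* j)       ≈⟨ -‿cong (ι-* (+ suc m) j) ⟩
    - (ι (+ suc m) * ι j)       ≈⟨ -‿distribˡ-* _ _ ⟩
    ι -[1+ m ] * ι j            ∎

  ι-1 : ι 1ℤ ≈ 1#
  ι-1 = +-identityʳ 1#

  private
    ι-morphism : ℤ.+-*-rawRing -Raw-AlmostCommutative⟶ fromCommutativeRing commutativeRing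
    ι-morphism = record
      { ⟦_⟧    = ι
      ; +-homo = ι-+
      ; *-homo = ι-*
      ; -‿homo = ι-neg
      ; 0-homo = refl
      ; 1-homo = ι-1
      }

    ι-≟ : WeaklyDecidable (λ i j → ι i ≈ ι j)
    ι-≟ i j with i ℤ.≟ j
    ... | yes i≡j = just (reflexive (cong ι i≡j))
    ... | no  _   = nothing

  open Algebra.Solver.Ring ℤ.+-*-rawRing (fromCommutativeRing commutativeRing) ι-morphism ι-≟ public
    using (solve; con; _:=_; _:+_; _:*_; _:-_; :-_)

  <⇒≤ : ∀ {x y} → x < y → x ≤ y
  <⇒≤ x<y y<x = <-irrefl refl (<-trans x<y y<x)

  ≤-reflexive : ∀ {x y} → x ≈ y → x ≤ y
  ≤-reflexive x≈y y<x = <-irrefl (sym x≈y) y<x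

  <-≤-trans : ∀ {x y z} → x < y → y ≤ z → x < z
  <-≤-trans {z = z} x<y y≤z with <-cotransitive x<y z
  ... | inj₁ x<z = x<z
  ... | inj₂ z<y = contradiction z<y y≤z

  ≤-<-trans : ∀ {x y z} → x ≤ y → y < z → x < z
  ≤-<-trans {x = x} x≤y y<z with <-cotransitive y<z x
  ... | inj₁ y<x = contradiction y<x x≤y
  ... | inj₂ x<z = x<z

  ≤-trans : ∀ {x y z} → x ≤ y → y ≤ z → x ≤ z
  ≤-trans x≤y y≤z z<x = y≤z (<-≤-trans z<x x≤y)

  ≤-antisym : ∀ {x y} → x ≤ y → y ≤ x → x ≈ y
  ≤-antisym x≤y y≤x = proj₁ (tight _ _) Sum.[ y≤x , x≤y ]

  ≤-resp-≈ : ∀ {x x′ y y′} → x ≈ x′ → y ≈ y′ → x ≤ y → x′ ≤ y′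
  ≤-resp-≈ x≈x′ y≈y′ x≤y y′<x′ = x≤y (<-respʳ-≈ (sym x≈x′) (<-respˡ-≈ (sym y≈y′) y′<x′))

  <-resp-≈ : ∀ {x x′ y y′} → x ≈ x′ → y ≈ y′ → x < y → x′ < y′
  <-resp-≈ x≈x′ y≈y′ x<y = <-respʳ-≈ y≈y′ (<-respˡ-≈ x≈x′ x<y)

  x<y⇒0<y-x : ∀ {x y} → x < y → 0# < y - x
  x<y⇒0<y-x {x} {y} x<y = <-respˡ-≈ (-‿inverseʳ x) (+-monoˡ-< (- x) x<y)

  0<y-x⇒x<y : ∀ {x y} → 0# < y - x → x < y
  0<y-x⇒x<y {x} {y} 0<y-x = <-resp-≈ (+-identityˡ x)
    (solve 2 (λ x y → y :- x :+ x := y) refl x y) (+-monoˡ-< x 0<y-x)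

  x≤y⇒0≤y-x : ∀ {x y} → x ≤ y → 0# ≤ y - x
  x≤y⇒0≤y-x {x} {y} x≤y y-x<0 = x≤y (<-resp-≈
    (solve 2 (λ x y → y :- x :+ x := y) refl x y) (+-identityˡ x) (+-monoˡ-< x y-x<0))

  0≤y-x⇒x≤y : ∀ {x y} → 0# ≤ y - x → x ≤ y
  0≤y-x⇒x≤y {x} {y} 0≤y-x y<x = 0≤y-x (<-respʳ-≈ (-‿inverseʳ x) (+-monoˡ-< (- x) y<x))

  +-nonneg : ∀ {x y} → 0# ≤ x → 0# ≤ y → 0# ≤ x + y
  +-nonneg {x} {y} 0≤x 0≤y = ≤-trans 0≤y (λ x+y<y → 0≤x (<-resp-≈
    (solve 2 (λ x y → x :+ y :- y := x) refl x y) (-‿inverseʳ y) (+-monoˡ-< (- y) x+y<y)))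

  +-nonneg-pos : ∀ {x y} → 0# ≤ x → 0# < y → 0# < x + y
  +-nonneg-pos {x} {y} 0≤x 0<y = ≤-<-trans 0≤x
    (<-resp-≈ (+-identityˡ x) (+-comm y x) (+-monoˡ-< x 0<y))

  +-pos-nonneg : ∀ {x y} → 0# < x → 0# ≤ y → 0# < x + y
  +-pos-nonneg 0<x 0≤y = <-respʳ-≈ (+-comm _ _) (+-nonneg-pos 0≤y 0<x)

  -- The goal is a negation, so positivity of both factors may be assumed once its failure is
  -- refuted: a nonnegative factor that is not positive is zero, and so is the product.
  *-nonneg : ∀ {x y} → 0# ≤ x → 0# ≤ y → 0# ≤ x * y
  *-nonneg {x} {y} 0≤x 0≤y xy<0 = ¬0<x λ 0<x → ¬0<y λ 0<y → <⇒≤ (*-pos 0<x 0<y) xy<0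
    where
    ¬0<x : ¬ (x ≤ 0#)
    ¬0<x 0≥x = <-irrefl (trans (*-congʳ (≤-antisym 0≥x 0≤x)) (zeroˡ y)) xy<0
    ¬0<y : ¬ (y ≤ 0#)
    ¬0<y 0≥y = <-irrefl (trans (*-congˡ (≤-antisym 0≥y 0≤y)) (zeroʳ x)) xy<0

  *-monoˡ-≤ : ∀ {x y} z → 0# ≤ z → x ≤ y → z * x ≤ z * y
  *-monoˡ-≤ {x} {y} z 0≤z x≤y = 0≤y-x⇒x≤y (≤-resp-≈ refl
    (solve 3 (λ x y z → z :* (y :- x) := z :* y :- z :* x) refl x y z) (*-nonneg 0≤z (x≤y⇒0≤y-x x≤y)))

  *-monoˡ-< : ∀ {x y} z → 0# < z → x < y → z * x < z * y
  *-monoˡ-< {x} {y} z 0<z x<y = 0<y-x⇒x<y (<-respʳ-≈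
    (solve 3 (λ x y z → z :* (y :- x) := z :* y :- z :* x) refl x y z) (*-pos 0<z (x<y⇒0<y-x x<y)))

  *-cancelˡ-≤ : ∀ {x y} z → 0# < z → z * x ≤ z * y → x ≤ y
  *-cancelˡ-≤ z 0<z zx≤zy y<x = zx≤zy (*-monoˡ-< z 0<z y<x)

  *-cancelˡ-≈ : ∀ {x y} z → 0# < z → z * x ≈ z * y → x ≈ y
  *-cancelˡ-≈ z 0<z zx≈zy = ≤-antisym (*-cancelˡ-≤ z 0<z (≤-reflexive zx≈zy))
                                      (*-cancelˡ-≤ z 0<z (≤-reflexive (sym zx≈zy)))

  abstract
    reciprocal : ∀ {x} → 0# < x → ∃[ y ] 0# < y × y * x ≈ 1#
    reciprocal {x} 0<x = y , 0<y , yx≈1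
      where
      x-0≈x : ∀ x → x - 0# ≈ x
      x-0≈x = solve 1 (λ x → x :- con 0ℤ := x) refl
      y : Carrier
      y = proj₁ (#⇒invertible (inj₂ 0<x))
      yx≈1 : y * x ≈ 1#
      yx≈1 = trans (*-congˡ (sym (x-0≈x x))) (proj₁ (proj₂ (#⇒invertible (inj₂ 0<x))))
      0<y : 0# < y
      0<y with invertible⇒# {y} {0#} (x , trans (*-congˡ (x-0≈x y)) (trans (*-comm x y) yx≈1)
                                       , trans (*-congʳ (x-0≈x y)) yx≈1)
      ... | inj₂ 0<y = 0<y
      ... | inj₁ y<0 = contradiction
        (<-resp-≈ (trans (*-comm x y) yx≈1) (zeroʳ x) (*-monoˡ-< x 0<x y<0)) (<⇒≤ 0<1)

  *-cancelˡ-< : ∀ {x y} z → 0# < z → z * x < z * y → x < y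
  *-cancelˡ-< z 0<z zx<zy with reciprocal 0<z
  ... | ρ , 0<ρ , ρz≈1 = <-resp-≈ (cancel _) (cancel _) (*-monoˡ-< ρ 0<ρ zx<zy)
    where
    cancel : ∀ x → ρ * (z * x) ≈ x
    cancel x = trans (sym (*-assoc ρ z x)) (trans (*-congʳ ρz≈1) (*-identityˡ x))

  ι-mono-< : ∀ {i j} → i ℤ.< j → ι i < ι j
  ι-mono-< {i} {j} i<j = 0<y-x⇒x<y (<-respʳ-≈ (trans (ι-+ j (ℤ.- i)) (+-congˡ (ι-neg i)))
    (positive (≡.subst (ℤ._< j ℤ.- i) (ℤ.+-inverseʳ i) (ℤ.+-monoˡ-< (ℤ.- i) i<j))))
    where
    positive : ∀ {k} → 0ℤ ℤ.< k → 0# < ι k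
    positive {+ suc n} _ = 0<n×1 (suc n)
    positive {+ zero} (ℤ.+<+ ())

  ι-mono-≤ : ∀ {i j} → i ℤ.≤ j → ι i ≤ ι j
  ι-mono-≤ {i} {j} i≤j with ℤ.<-cmp i j
  ... | tri< i<j _ _ = <⇒≤ (ι-mono-< i<j)
  ... | tri≈ _ i≡j _ = ≤-reflexive (reflexive (cong ι i≡j))
  ... | tri> _ _ j<i = contradiction j<i (ℤ.≤⇒≯ i≤j)

  ι-cancel-< : ∀ {i j} → ι i < ι j → i ℤ.< j
  ι-cancel-< ιi<ιj = ℤ.≰⇒> λ j≤i → ι-mono-≤ j≤i ιi<ιj

  ι-injective : ∀ {i j} → ι i ≈ ι j → i ≡ j
  ι-injective {i} {j} ιi≈ιj with ℤ.<-cmp i j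
  ... | tri< i<j _ _ = contradiction (ι-mono-< i<j) (<-irrefl ιi≈ιj)
  ... | tri≈ _ i≡j _ = i≡j
  ... | tri> _ _ j<i = contradiction (ι-mono-< j<i) (<-irrefl (sym ιi≈ιj))

  sum-nonneg : ∀ {n} {x : Vector Carrier n} → (∀ i → 0# ≤ x i) → 0# ≤ sum x
  sum-nonneg {zero}  0≤x = ≤-reflexive refl
  sum-nonneg {suc n} 0≤x = +-nonneg (0≤x zero) (sum-nonneg (0≤x ∘ suc))

  sum-positive : ∀ {n} {x : Vector Carrier n} → (∀ i → 0# ≤ x i) → ∀ i → 0# < x i → 0# < sum x
  sum-positive 0≤x zero    0<xᵢ = +-pos-nonneg 0<xᵢ (sum-nonneg (0≤x ∘ suc))
  sum-positive 0≤x (suc i) 0<xᵢ = +-nonneg-pos (0≤x zero) (sum-positive (0≤x ∘ suc) i 0<xᵢ)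

  abstract
    -- Cotransitivity replaces a decision on signs: either the head is positive, or it lies below
    -- the sum and the tail has positive sum.
    positive-summand : ∀ {n} (x : Vector Carrier n) → 0# < sum x → ∃[ i ] 0# < x i
    positive-summand {zero}  x 0<0 = contradiction 0<0 (<-irrefl refl)
    positive-summand {suc n} x 0<Σ with <-cotransitive 0<Σ (x zero)
    ... | inj₁ 0<x₀ = zero , 0<x₀
    ... | inj₂ x₀<Σ with positive-summand (x ∘ suc) (<-resp-≈ (-‿inverseʳ _)
                           (solve 2 (λ a b → a :+ b :- a := b) refl _ _) (+-monoˡ-< (- x zero) x₀<Σ))
    ...   | i , 0<xᵢ = suc i , 0<xᵢ

  sum-zero-nonneg : ∀ {n} {x : Vector Carrier n} → (∀ i → 0# ≤ x i) → sum x ≈ 0# → ∀ i → x i ≈ 0#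
  sum-zero-nonneg 0≤x Σ≈0 i = ≤-antisym (λ 0<xᵢ → <-irrefl (sym Σ≈0) (sum-positive 0≤x i 0<xᵢ)) (0≤x i)

  +-mono-≤ : ∀ {x x′ y y′} → x ≤ x′ → y ≤ y′ → x + y ≤ x′ + y′
  +-mono-≤ {x} {x′} {y} {y′} x≤x′ y≤y′ = 0≤y-x⇒x≤y (≤-resp-≈ refl
    (solve 4 (λ x x′ y y′ → (x′ :- x) :+ (y′ :- y) := (x′ :+ y′) :- (x :+ y)) refl x x′ y y′)
    (+-nonneg (x≤y⇒0≤y-x x≤x′) (x≤y⇒0≤y-x y≤y′)))

  sum-mono-≤ : ∀ {n} {x y : Vector Carrier n} → (∀ i → x i ≤ y i) → sum x ≤ sum y
  sum-mono-≤ {zero}  x≤y = ≤-reflexive refl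
  sum-mono-≤ {suc n} x≤y = +-mono-≤ (x≤y zero) (sum-mono-≤ (x≤y ∘ suc))

  sum-neg : ∀ {n} (x : Vector Carrier n) → sum (λ i → - x i) ≈ - sum x
  sum-neg {zero}  x = sym -0#≈0#
  sum-neg {suc n} x = trans (+-congˡ (sum-neg (x ∘ suc))) (-‿+-comm _ _)

  ι-sum : ∀ {n} (x : Vector ℤ n) → ι (Determinant.sum x) ≈ sum (λ i → ι (x i))
  ι-sum {zero}  x = refl
  ι-sum {suc n} x = trans (ι-+ (x zero) _) (+-congˡ (ι-sum (x ∘ suc)))

  ι-⟨⟩ : ∀ {n} (x y : Vector ℤ n) → ι (Determinant.sum (λ i → x i ℤ.* y i)) ≈ ⟨ ιᵛ x , ιᵛ y ⟩
  ι-⟨⟩ x y = trans (ι-sum (λ i → x i ℤ.* y i)) (sum-cong-≋ (λ i → ι-* (x i) (y i)))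

  ι-e : ∀ {n} (i j : Fin n) → ι (Determinant.e i j) ≈ e i j
  ι-e zero    zero    = ι-1
  ι-e zero    (suc j) = refl
  ι-e (suc i) zero    = refl
  ι-e (suc i) (suc j) = ι-e i j

  sum-e : ∀ {n} (x : Vector Carrier n) i → sum (λ j → x j * e i j) ≈ x i
  sum-e x zero = trans (+-cong (*-identityʳ _) (sum-zero (λ j → zeroʳ (x (suc j))))) (+-identityʳ _)
  sum-e x (suc i) = trans (+-cong (zeroʳ _) (sum-e (x ∘ suc) i)) (+-identityˡ _)

  e-sym : ∀ {n} (i j : Fin n) → e i j ≈ e j i
  e-sym zero    zero    = refl
  e-sym zero    (suc j) = refl
  e-sym (suc i) zero    = refl
  e-sym (suc i) (suc j) = e-sym i j

  sum-* : ∀ {n} a (x : Vector Carrier n) → sum (λ i → a * x i) ≈ a * sum x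
  sum-* a x = sym (*-distribˡ-sum a x)

  sum-sub : ∀ {n} (x y : Vector Carrier n) → sum (λ i → x i - y i) ≈ sum x - sum y
  sum-sub x y = trans (∑-distrib-+ x (λ i → - y i)) (+-congˡ (sum-neg y))

  e-diagonal : ∀ {n} (i : Fin n) → e i i ≈ 1#
  e-diagonal i = trans (sym (ι-e i i)) (trans (reflexive (cong ι (Determinant.e-diagonal i))) ι-1)

  e-off-diagonal : ∀ {n} {i j : Fin n} → i ≢ j → e i j ≈ 0#
  e-off-diagonal {i = i} {j} i≢j = trans (sym (ι-e i j)) (reflexive (cong ι (Determinant.e-off-diagonal i≢j)))

  0≤e : ∀ {n} (i j : Fin n) → 0# ≤ e i j
  0≤e zero    zero    = <⇒≤ 0<1
  0≤e zero    (suc j) = ≤-reflexive refl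
  0≤e (suc i) zero    = ≤-reflexive refl
  0≤e (suc i) (suc j) = 0≤e i j

  sum-single : ∀ {n} (x : Vector Carrier n) i → (∀ j → i ≢ j → x j ≈ 0#) → sum x ≈ x i
  sum-single {n} x i x≈0 = trans (sum-cong-≋ {n} masked) (sum-e x i)
    where
    masked : ∀ j → x j ≈ x j * e i j
    masked j with i ≟ j
    ... | yes ≡.refl = sym (trans (*-congˡ (e-diagonal i)) (*-identityʳ _))
    ... | no  i≢j    = trans (x≈0 j i≢j) (sym (trans (*-congʳ (x≈0 j i≢j)) (zeroˡ _)))

  linear-cong : ∀ {d} {φ : Point d → Carrier} → IsLinear φ → ∀ {x y} → x ≋ y → φ x ≈ φ y
  linear-cong {φ = φ} lin {x} {y} x≋y = trans
    (lin 1# 0# {y = y} {z = y} (λ j → trans (x≋y j) (sym (unit (y j))))) (unit (φ y))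
    where
    unit : ∀ y → 1# * y + 0# * y ≈ y
    unit y = trans (+-cong (*-identityˡ y) (zeroˡ y)) (+-identityʳ y)

  linear-combination : ∀ {n d} {φ : Point d → Carrier} → IsLinear φ →
                       ∀ (a : Vector Carrier n) v → φ (combination a v) ≈ sum (λ i → a i * φ (v i))
  linear-combination {zero} {φ = φ} lin a v = trans
    (lin 0# 0# {y = 𝟎} {z = 𝟎} (λ j → sym (trans (+-cong (zeroˡ _) (zeroˡ _)) (+-identityˡ 0#))))
    (trans (+-cong (zeroˡ _) (zeroˡ _)) (+-identityˡ 0#))
  linear-combination {suc n} {φ = φ} lin a v = trans
    (lin (a zero) 1# (λ j → +-congˡ (sym (*-identityˡ _))))
    (+-congˡ (trans (*-identityˡ _) (linear-combination lin (a ∘ suc) (v ∘ suc))))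

  linear-zero : ∀ {d} {φ : Point d → Carrier} → IsLinear φ → ∀ {x} → x ≋ 𝟎 → φ x ≈ 0#
  linear-zero {φ = φ} lin {x} x≋0 = trans
    (lin 0# 0# {y = x} {z = x} (λ j → trans (x≋0 j) (sym (zero-sum (x j)))))
    (zero-sum (φ x))
    where
    zero-sum : ∀ y → 0# * y + 0# * y ≈ 0#
    zero-sum y = trans (+-cong (zeroˡ _) (zeroˡ _)) (+-identityˡ 0#)

  linear-+ : ∀ {d} {φ : Point d → Carrier} → IsLinear φ → ∀ x y → φ (x ⊕ y) ≈ φ x + φ y
  linear-+ lin x y = trans (lin 1# 1# (λ j → sym (+-cong (*-identityˡ _) (*-identityˡ _))))
    (+-cong (*-identityˡ _) (*-identityˡ _))

  linear-· : ∀ {d} {φ : Point d → Carrier} → IsLinear φ → ∀ a x → φ (a · x) ≈ a * φ x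
  linear-· lin a x = trans (lin a 0# {z = x} (λ j → sym (trans (+-congˡ (zeroˡ _)) (+-identityʳ _))))
    (trans (+-congˡ (zeroˡ _)) (+-identityʳ _))

  ⟨⟩-comm : ∀ {d} (x y : Point d) → ⟨ x , y ⟩ ≈ ⟨ y , x ⟩
  ⟨⟩-comm x y = sum-cong-≋ (λ j → *-comm (x j) (y j))

  ⟨⟩-linearˡ : ∀ {d} (y : Point d) → IsLinear (λ x → ⟨ x , y ⟩)
  ⟨⟩-linearˡ y a b {x} {x₁} {x₂} h = begin
    sum (λ j → x j * y j)
      ≈⟨ sum-cong-≋ (λ j → trans (*-congʳ (h j))
           (solve 5 (λ a b p q y → (a :* p :+ b :* q) :* y := a :* (p :* y) :+ b :* (q :* y)) refl
              a b (x₁ j) (x₂ j) (y j))) ⟩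
    sum (λ j → a * (x₁ j * y j) + b * (x₂ j * y j))
      ≈⟨ ∑-distrib-+ (λ j → a * (x₁ j * y j)) (λ j → b * (x₂ j * y j)) ⟩
    sum (λ j → a * (x₁ j * y j)) + sum (λ j → b * (x₂ j * y j))
      ≈⟨ +-cong (*-distribˡ-sum a (λ j → x₁ j * y j)) (*-distribˡ-sum b (λ j → x₂ j * y j)) ⟨
    a * ⟨ x₁ , y ⟩ + b * ⟨ x₂ , y ⟩  ∎

  ⟨⟩-linearʳ : ∀ {d} (x : Point d) → IsLinear (λ y → ⟨ x , y ⟩)
  ⟨⟩-linearʳ x a b {y} {y₁} {y₂} h = trans (⟨⟩-comm x y) (trans (⟨⟩-linearˡ x a b h)
    (+-cong (*-congˡ (⟨⟩-comm y₁ x)) (*-congˡ (⟨⟩-comm y₂ x))))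

  abstract
    -- Successive bounds are added, which avoids having to choose the larger of two reals.
    bounded : ∀ {n} (x : Vector Carrier n) → ∃[ M ] 0# < M × (∀ i → x i < M)
    bounded {zero}  x = 1# , 0<1 , λ ()
    bounded {suc n} x with bounded (x ∘ suc) | archimedean (x zero)
    ... | M , 0<M , x<M | N , x₀<N = M + N ×ₙ 1# , +-pos-nonneg 0<M 0≤N , λ where
        zero    → <-trans x₀<N (<-resp-≈ (+-identityˡ _) refl (+-monoˡ-< (N ×ₙ 1#) 0<M))
        (suc i) → <-≤-trans (x<M i) (≤-resp-≈ (+-identityʳ M) refl (+-mono-≤ (≤-reflexive refl) 0≤N))
      where
      0≤N : 0# ≤ N ×ₙ 1#
      0≤N = ι-mono-≤ {0ℤ} {+ N} (ℤ.+≤+ ℕ.z≤n)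

    small-multiple : ∀ {n} (x : Vector Carrier n) ε → 0# < ε →
                     ∃[ δ ] 0# < δ × (∀ j → (δ * x j < ε) × (- (δ * x j) < ε))
    small-multiple x ε 0<ε with bounded x | bounded (λ j → - x j)
    ... | M , 0<M , x<M | M′ , 0<M′ , -x<M′ with reciprocal (+-pos-nonneg 0<M (<⇒≤ 0<M′))
    -- With `M` and `M′` bounding the entries of `x` and of its negative, δ is ε / (M + M′).
    ...   | ρ , 0<ρ , ρK≈1 = ε * ρ , 0<δ , λ j →
        <-respʳ-≈ δK≈ε (*-monoˡ-< (ε * ρ) 0<δ (<-trans (x<M j) (<-respˡ-≈ (+-identityʳ M)
          (<-resp-≈ (+-comm _ _) (+-comm _ _) (+-monoˡ-< M 0<M′))))) ,
        <-resp-≈ (sym (-‿distribʳ-* (ε * ρ) (x j))) δK≈ε (*-monoˡ-< (ε * ρ) 0<δ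
          (<-trans (-x<M′ j) (<-respˡ-≈ (+-identityˡ M′) (+-monoˡ-< M′ 0<M))))
      where
      0<δ : 0# < ε * ρ
      0<δ = *-pos 0<ε 0<ρ
      δK≈ε : ε * ρ * (M + M′) ≈ ε
      δK≈ε = trans (*-assoc ε ρ _) (trans (*-congˡ ρK≈1) (*-identityʳ ε))

  private
    -- 2(εM - xy) = (ε - x)(M + y) + (ε + x)(M - y) is a sum of products of positive numbers; this
    -- does the work of multiplying absolute values.
    *-bound : ∀ {x y ε M} → x < ε → - x < ε → y < M → - y < M → x * y ≤ ε * M
    *-bound {x} {y} {ε} {M} x<ε -x<ε y<M -y<M = *-cancelˡ-≤ (ι (+ 2)) (0<n×1 2) (0≤y-x⇒x≤y (≤-resp-≈ refl
      (solve 4 (λ x y ε M → (ε :- x) :* (M :- (:- y)) :+ (ε :- (:- x)) :* (M :- y) :=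
                            con (+ 2) :* (ε :* M) :- con (+ 2) :* (x :* y)) refl x y ε M)
      (+-nonneg (<⇒≤ (*-pos (x<y⇒0<y-x x<ε) (x<y⇒0<y-x -y<M)))
                (<⇒≤ (*-pos (x<y⇒0<y-x -x<ε) (x<y⇒0<y-x y<M))))))

  abstract
    small-forms : ∀ {n d} (g : Fin n → Point d) →
      ∃[ ε ] 0# < ε × (∀ y → (∀ j → (y j < ε) × (- y j < ε)) → ∀ i → ⟨ y , g i ⟩ < 1#)
    small-forms {n} {d} g with bounded (λ i → proj₁ (bounded (g i)) + proj₁ (bounded (λ j → - g i j)))
    ... | M , 0<M , g<M with reciprocal (+-nonneg-pos (sum-nonneg {d} {λ _ → M} (λ _ → <⇒≤ 0<M)) 0<1)
    -- Here ε = 1 / (dM + 1), with `M` above all entries of all `g i` and of their negatives. The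
    -- summand 1 makes the estimate ε · dM < 1 strict.
    ...   | ε , 0<ε , εK≈1 = ε , 0<ε , λ y y-small i →
        ≤-<-trans (sum-mono-≤ λ j → *-bound (proj₁ (y-small j)) (proj₂ (y-small j)) (above i j) (below i j))
          (<-resp-≈ (trans (+-identityˡ _) (*-distribˡ-sum {d} ε (λ _ → M)))
            (trans (solve 2 (λ ε K → ε :+ ε :* K := ε :* (K :+ con 1ℤ)) refl ε _)
                   (trans (*-congˡ (+-congˡ ι-1)) εK≈1))
            (+-monoˡ-< (ε * sum {d} (λ _ → M)) 0<ε))
      where
      above : ∀ i j → g i j < M
      above i j with bounded (g i) | bounded (λ j → - g i j) | g<M i
      ... | A , _ , g<A | A′ , 0<A′ , _ | A+A′<M =
        <-trans (g<A j) (<-trans (<-resp-≈ (+-identityˡ A) (+-comm _ _) (+-monoˡ-< A 0<A′)) A+A′<M)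
      below : ∀ i j → - g i j < M
      below i j with bounded (g i) | bounded (λ j → - g i j) | g<M i
      ... | A , 0<A , _ | A′ , _ , -g<A′ | A+A′<M =
        <-trans (-g<A′ j) (<-trans (<-resp-≈ (+-identityˡ A′) refl (+-monoˡ-< A′ 0<A)) A+A′<M)

-- Reflexivity of translated dilates of a lattice simplex.

module Simplices {r ℓ₁ ℓ₂ : Level} (ℝ : Reals r ℓ₁ ℓ₂) where
  open RealAlgebra ℝ

  -- P is cut out by its barycentric coordinates x ↦ b i + l i x.
  record LatticeSimplex (n : ℕ) {d : ℕ} (P : Pred (Point d) (r ⊔ ℓ₂)) : Set (r ⊔ ℓ₁ ⊔ ℓ₂) where
    field
      vertex       : Fin n → Vector ℤ d
      -- `b` consists of the barycentric coordinates of the origin, and `l` of the linear parts.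
      b            : Vector Carrier n
      l            : Fin n → Point d → Carrier
      l-linear     : ∀ i → IsLinear (l i)
      Σb≈1         : sum b ≈ 1#
      Σl≈0         : ∀ x → sum (λ i → l i x) ≈ 0#
      Σb-vertex    : ∀ j → sum (λ i → b i * ι (vertex i j)) ≈ 0#
      Σl-vertex    : ∀ x j → sum (λ i → l i x * ι (vertex i j)) ≈ x j
      l-vertex     : ∀ i m → b i + l i (ιᵛ (vertex m)) ≈ e i m
      ∈⇒0≤         : ∀ {x} → x ∈ P → ∀ i → 0# ≤ b i + l i x
      0≤⇒∈         : ∀ {x} → (∀ i → 0# ≤ b i + l i x) → x ∈ P
      -- Signs of reals cannot be decided in general; the simplex has to provide them at the lattice
      -- points of its dilations.
      trichotomous : ∀ c (z : Vector ℤ d) i → let B = (c ×ₙ 1#) * b i + l i (ιᵛ z) in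
                     B < 0# ⊎ B ≈ 0# ⊎ 0# < B

  module Criterion {n d : ℕ} {P : Pred (Point d) (r ⊔ ℓ₂)} (S : LatticeSimplex n P) where
    open LatticeSimplex S

    -- The facet normals of c P - w, scaled so that the facets have height 1, are
    -- lattice vectors.
    HasUnitNormals : ℕ → Vector ℤ d → Set (r ⊔ ℓ₁ ⊔ ℓ₂)
    HasUnitNormals c w = (∀ i → 0# < (c ×ₙ 1#) * b i + l i (ιᵛ w)) ×
      (∀ i → ∃[ q ] ∀ y → ((c ×ₙ 1#) * b i + l i (ιᵛ w)) * ⟨ y , ιᵛ q ⟩ ≈ - l i y)

    module Dilation (c : ℕ) .{{_ : NonZero c}} (w : Vector ℤ d) where

      κ : Carrier
      κ = c ×ₙ 1#

      0<κ : 0# < κ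
      0<κ = 0<n×1 c

      κ⁻¹ : Carrier
      κ⁻¹ = proj₁ (reciprocal 0<κ)

      0<κ⁻¹ : 0# < κ⁻¹
      0<κ⁻¹ = proj₁ (proj₂ (reciprocal 0<κ))

      κ⁻¹κ≈1 : κ⁻¹ * κ ≈ 1#
      κ⁻¹κ≈1 = proj₂ (proj₂ (reciprocal 0<κ))

      κ⁻¹*[κ*x]≈x : ∀ x → κ⁻¹ * (κ * x) ≈ x
      κ⁻¹*[κ*x]≈x x = trans (sym (*-assoc _ _ _)) (trans (*-congʳ κ⁻¹κ≈1) (*-identityˡ x))

      κ*[κ⁻¹*x]≈x : ∀ x → κ * (κ⁻¹ * x) ≈ x
      κ*[κ⁻¹*x]≈x x = trans (sym (*-assoc _ _ _))
        (trans (*-congʳ (trans (*-comm _ _) κ⁻¹κ≈1)) (*-identityˡ x))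

      -- The heights of the origin over the facets of `c P - w`; up to the factor c, its barycentric
      -- coordinates with respect to the points `V`.
      ω : Vector Carrier n
      ω i = κ * b i + l i (ιᵛ w)

      -- The i-th facet functional of c P at y + w.
      A : Fin n → Point d → Carrier
      A i y = ω i + l i y

      -- The vertices of `c P - w`.
      V : Fin n → Vector ℤ d
      V m j = + c ℤ.* vertex m j ℤ.+ (ℤ.- w j)

      ι-V : ∀ m j → ι (V m j) ≈ κ * ι (vertex m j) - ι (w j)
      ι-V m j = trans (ι-+ (+ c ℤ.* vertex m j) (ℤ.- w j)) (+-cong (ι-* (+ c) (vertex m j)) (ι-neg (w j)))

      combination-V : ∀ (g : Vector Carrier n) j →
                      combination g (ιᵛ ∘ V) j ≈ κ * sum (λ i → g i * ι (vertex i j)) - sum g * ι (w j)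
      combination-V g j = begin
        sum (λ i → g i * ι (V i j))
          ≈⟨ sum-cong-≋ {n} (λ i → trans (*-congˡ (ι-V i j))
               (solve 4 (λ g κ v w → g :* (κ :* v :- w) := κ :* (g :* v) :- w :* g) refl
                  (g i) κ (ι (vertex i j)) (ι (w j)))) ⟩
        sum (λ i → κ * (g i * ι (vertex i j)) - ι (w j) * g i)
          ≈⟨ sum-sub {n} _ (λ i → ι (w j) * g i) ⟩
        sum (λ i → κ * (g i * ι (vertex i j))) - sum (λ i → ι (w j) * g i)
          ≈⟨ +-cong (sum-* {n} κ _) (-‿cong (trans (sum-* (ι (w j)) g) (*-comm _ _))) ⟩
        κ * sum (λ i → g i * ι (vertex i j)) - sum g * ι (w j)  ∎

      Σω≈κ : sum ω ≈ κ
      Σω≈κ = trans (∑-distrib-+ (λ i → κ * b i) (λ i → l i (ιᵛ w)))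
        (trans (+-cong (trans (sum-* κ b) (trans (*-congˡ Σb≈1) (*-identityʳ κ))) (Σl≈0 (ιᵛ w)))
               (+-identityʳ κ))

      Σω-vertex : ∀ j → sum (λ i → ω i * ι (vertex i j)) ≈ ι (w j)
      Σω-vertex j = begin
        sum (λ i → ω i * ι (vertex i j))
          ≈⟨ sum-cong-≋ {n} (λ i → trans (distribʳ _ _ _) (+-congʳ (*-assoc _ _ _))) ⟩
        sum (λ i → κ * (b i * ι (vertex i j)) + l i (ιᵛ w) * ι (vertex i j))
          ≈⟨ ∑-distrib-+ (λ i → κ * (b i * ι (vertex i j))) (λ i → l i (ιᵛ w) * ι (vertex i j)) ⟩
        sum (λ i → κ * (b i * ι (vertex i j))) + sum (λ i → l i (ιᵛ w) * ι (vertex i j))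
          ≈⟨ +-cong (trans (sum-* {n} κ _) (trans (*-congˡ (Σb-vertex j)) (zeroʳ κ))) (Σl-vertex (ιᵛ w) j) ⟩
        0# + ι (w j)  ≈⟨ +-identityˡ _ ⟩
        ι (w j)       ∎

      ΣωV≈0 : ∀ j → combination ω (ιᵛ ∘ V) j ≈ 0#
      ΣωV≈0 j = trans (combination-V ω j)
        (trans (+-cong (*-congˡ (Σω-vertex j)) (-‿cong (*-congʳ Σω≈κ))) (-‿inverseʳ _))

      ΣlV≈κ : ∀ y j → combination (λ i → l i y) (ιᵛ ∘ V) j ≈ κ * y j
      ΣlV≈κ y j = trans (combination-V (λ i → l i y) j)
        (trans (+-cong (*-congˡ (Σl-vertex y j)) (trans (-‿cong (trans (*-congʳ (Σl≈0 y)) (zeroˡ _))) -0#≈0#))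
               (+-identityʳ _))

      A-V : ∀ i m → A i (ιᵛ (V m)) ≈ κ * e i m
      A-V i m = begin
        κ * b i + l i (ιᵛ w) + l i (ιᵛ (V m))
          ≈⟨ +-congˡ (l-linear i κ (- 1#) (λ j → trans (ι-V m j) (+-congˡ
               (trans (-‿cong (sym (*-identityˡ _))) (-‿distribˡ-* _ _))))) ⟩
        κ * b i + l i (ιᵛ w) + (κ * l i (ιᵛ (vertex m)) + - 1# * l i (ιᵛ w))
          ≈⟨ +-congˡ (+-congˡ (trans (sym (-‿distribˡ-* _ _)) (-‿cong (*-identityˡ _)))) ⟩
        κ * b i + l i (ιᵛ w) + (κ * l i (ιᵛ (vertex m)) - l i (ιᵛ w))
          ≈⟨ solve 4 (λ κ b w v → κ :* b :+ w :+ (κ :* v :- w) := κ :* (b :+ v)) refl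
               κ (b i) (l i (ιᵛ w)) (l i (ιᵛ (vertex m))) ⟩
        κ * (b i + l i (ιᵛ (vertex m)))  ≈⟨ *-congˡ (l-vertex i m) ⟩
        κ * e i m                        ∎

      0≤A-V : ∀ i m → 0# ≤ A i (ιᵛ (V m))
      0≤A-V i m = ≤-resp-≈ refl (sym (A-V i m)) (*-nonneg (<⇒≤ 0<κ) (0≤e i m))

      A-origin : ∀ i {y} → y ≋ 𝟎 → A i y ≈ ω i
      A-origin i y≋0 = trans (+-congˡ (linear-zero (l-linear i) y≋0)) (+-identityʳ _)

      -- `X` is any description of `c P - w`. The parameter serves two uses in different universes:
      -- the reflexive translate, and `P` itself as the case c = 1, w = 0.
      module Region {p : Level} {X : Pred (Point d) p}
                    (X⇒ : ∀ {y} → y ∈ X → ∀ i → 0# ≤ A i y)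
                    (X⇐ : ∀ {y} → (∀ i → 0# ≤ A i y) → y ∈ X) where

        weight : Point d → Vector Carrier n
        weight y i = κ⁻¹ * A i y

        Σweight≈1 : ∀ y → sum (weight y) ≈ 1#
        Σweight≈1 y = begin
          sum (weight y)                       ≈⟨ sum-* κ⁻¹ (λ i → A i y) ⟩
          κ⁻¹ * sum (λ i → A i y)              ≈⟨ *-congˡ (∑-distrib-+ ω (λ i → l i y)) ⟩
          κ⁻¹ * (sum ω + sum (λ i → l i y))    ≈⟨ *-congˡ (+-cong Σω≈κ (Σl≈0 y)) ⟩
          κ⁻¹ * (κ + 0#)                       ≈⟨ *-congˡ (+-identityʳ κ) ⟩
          κ⁻¹ * κ                              ≈⟨ κ⁻¹κ≈1 ⟩
          1#                                   ∎

        weight-combination : ∀ y → y ≋ combination (weight y) (ιᵛ ∘ V)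
        weight-combination y j = sym (begin
          sum (λ i → κ⁻¹ * A i y * ι (V i j))
            ≈⟨ sum-cong-≋ {n} (λ i → trans (*-assoc _ _ _) (*-congˡ (distribʳ _ _ _))) ⟩
          sum (λ i → κ⁻¹ * (ω i * ι (V i j) + l i y * ι (V i j)))
            ≈⟨ trans (sum-* {n} κ⁻¹ _) (*-congˡ (∑-distrib-+ (λ i → ω i * ι (V i j)) (λ i → l i y * ι (V i j)))) ⟩
          κ⁻¹ * (combination ω (ιᵛ ∘ V) j + combination (λ i → l i y) (ιᵛ ∘ V) j)
            ≈⟨ *-congˡ (trans (+-cong (ΣωV≈0 j) (ΣlV≈κ y j)) (+-identityˡ _)) ⟩
          κ⁻¹ * (κ * y j)  ≈⟨ κ⁻¹*[κ*x]≈x (y j) ⟩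
          y j              ∎)

        A-combination : ∀ i {a : Vector Carrier n} {y} → sum a ≈ 1# → y ≋ combination a (ιᵛ ∘ V) →
                        A i y ≈ sum (λ m → a m * A i (ιᵛ (V m)))
        A-combination i {a} {y} Σa≈1 y≋ = begin
          ω i + l i y
            ≈⟨ +-cong (trans (sym (*-identityʳ _)) (*-congˡ (sym Σa≈1)))
                      (trans (linear-cong (l-linear i) y≋) (linear-combination (l-linear i) a (ιᵛ ∘ V))) ⟩
          ω i * sum a + sum (λ m → a m * l i (ιᵛ (V m)))
            ≈⟨ +-congʳ (trans (*-distribˡ-sum (ω i) a) (sum-cong-≋ {n} (λ m → *-comm (ω i) (a m)))) ⟩
          sum (λ m → a m * ω i) + sum (λ m → a m * l i (ιᵛ (V m)))
            ≈⟨ ∑-distrib-+ (λ m → a m * ω i) (λ m → a m * l i (ιᵛ (V m))) ⟨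
          sum (λ m → a m * ω i + a m * l i (ιᵛ (V m)))
            ≈⟨ sum-cong-≋ {n} (λ m → sym (distribˡ (a m) _ _)) ⟩
          sum (λ m → a m * A i (ιᵛ (V m)))  ∎

        isLatticePolytope : IsLatticePolytope X
        isLatticePolytope = n , V ,
          (λ {y} y∈X → weight y , (λ i → *-nonneg (<⇒≤ 0<κ⁻¹) (X⇒ y∈X i)) , Σweight≈1 y , weight-combination y) ,
          λ { (a , 0≤a , Σa≈1 , y≋) → X⇐ λ i → ≤-resp-≈ refl (sym (A-combination i Σa≈1 y≋))
                (sum-nonneg λ m → *-nonneg (0≤a m) (0≤A-V i m)) }

        isFullDimensional : IsFullDimensional X
        isFullDimensional y = n , ιᵛ ∘ V , weight y , (λ m → X⇐ λ i → 0≤A-V i m) , Σweight≈1 y , weight-combination y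

      dilate⁺ : ∀ {y} → (∀ i → 0# ≤ A i y) → (y ⊕ ιᵛ w) ∈ dilate c P
      dilate⁺ {y} 0≤A = κ⁻¹ · x , 0≤⇒∈ (λ i → *-cancelˡ-≤ κ 0<κ (≤-resp-≈ (sym (zeroʳ κ)) (begin
          ω i + l i y
            ≈⟨ solve 3 (λ B w y → B :+ w :+ y := B :+ (y :+ w)) refl (κ * b i) (l i (ιᵛ w)) (l i y) ⟩
          κ * b i + (l i y + l i (ιᵛ w))    ≈⟨ +-congˡ (linear-+ (l-linear i) y (ιᵛ w)) ⟨
          κ * b i + l i x                   ≈⟨ +-congˡ (κ*[κ⁻¹*x]≈x (l i x)) ⟨
          κ * b i + κ * (κ⁻¹ * l i x)       ≈⟨ +-congˡ (*-congˡ (linear-· (l-linear i) κ⁻¹ x)) ⟨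
          κ * b i + κ * l i (κ⁻¹ · x)       ≈⟨ distribˡ _ _ _ ⟨
          κ * (b i + l i (κ⁻¹ · x))         ∎) (0≤A i))) ,
        λ j → sym (κ*[κ⁻¹*x]≈x (x j))
        where
        x : Point d
        x = y ⊕ ιᵛ w

      dilate⁻ : ∀ {x y} → x ∈ dilate c P → x ≋ y ⊕ ιᵛ w → ∀ i → 0# ≤ A i y
      dilate⁻ {x} {y} (p , p∈P , x≋κp) x≋y+w i = ≤-resp-≈ refl (begin
        κ * (b i + l i p)               ≈⟨ distribˡ _ _ _ ⟩
        κ * b i + κ * l i p             ≈⟨ +-congˡ (linear-· (l-linear i) κ p) ⟨
        κ * b i + l i (κ · p)           ≈⟨ +-congˡ (linear-cong (l-linear i) (λ j → trans (sym (x≋κp j)) (x≋y+w j))) ⟩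
        κ * b i + l i (y ⊕ ιᵛ w)        ≈⟨ +-congˡ (linear-+ (l-linear i) y (ιᵛ w)) ⟩
        κ * b i + (l i y + l i (ιᵛ w))
          ≈⟨ solve 3 (λ B w y → B :+ (y :+ w) := B :+ w :+ y) refl (κ * b i) (l i (ιᵛ w)) (l i y) ⟩
        ω i + l i y                     ∎)
        (*-nonneg (<⇒≤ 0<κ) (∈⇒0≤ p∈P i))

    -- From integral normals to reflexivity.

    private
      f-e : ∀ (x : Point d) → f[ Determinant.e ] x ≋ x
      f-e x j = trans (sum-cong-≋ {d} (λ i → *-congˡ (trans (ι-e i j) (e-sym i j)))) (sum-e x j)

    module Sufficiency (c : ℕ) .{{_ : NonZero c}} (w : Vector ℤ d) (normals : HasUnitNormals c w) where
      open Dilation c w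

      private
        0<ω : ∀ i → 0# < ω i
        0<ω = proj₁ normals

        q : Fin n → Vector ℤ d
        q i = proj₁ (proj₂ normals i)

        q-normal : ∀ i y → ω i * ⟨ y , ιᵛ (q i) ⟩ ≈ - l i y
        q-normal i = proj₂ (proj₂ normals i)

        Q : Pred (Point d) (r ⊔ ℓ₁ ⊔ ℓ₂)
        Q = image (λ v → f[ Determinant.e ] v ⊕ ιᵛ (λ j → ℤ.- w j)) (dilate c P)

        ιw-cancel : ∀ y j → y + ι (w j) + ι (ℤ.- w j) ≈ y
        ιw-cancel y j = trans (+-congˡ (ι-neg (w j)))
          (solve 2 (λ y w → y :+ w :- w := y) refl y (ι (w j)))

        Q⇐ : ∀ {y} → (∀ i → 0# ≤ A i y) → y ∈ Q
        Q⇐ {y} 0≤A = y ⊕ ιᵛ w , dilate⁺ 0≤A , λ j →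
          sym (trans (+-congʳ (f-e (y ⊕ ιᵛ w) j)) (ιw-cancel (y j) j))

        Q⇒ : ∀ {y} → y ∈ Q → ∀ i → 0# ≤ A i y
        Q⇒ {y} (x , x∈cP , y≋) = dilate⁻ x∈cP λ j → sym (begin
          y j + ι (w j)                                            ≈⟨ +-congʳ (y≋ j) ⟩
          f[ Determinant.e ] x j + ι (ℤ.- w j) + ι (w j)           ≈⟨ +-cong (+-cong (f-e x j) (ι-neg (w j))) refl ⟩
          x j - ι (w j) + ι (w j)                                  ≈⟨ solve 2 (λ x w → x :- w :+ w := x) refl (x j) (ι (w j)) ⟩
          x j                                                      ∎)

        open Region {X = Q} Q⇒ Q⇐

        -- An interior point scaled by 1 + δ leaves Q through a facet containing it.
        ∉∂⇒0≉A : ∀ {y} → y ∈ Q → y ∉ ∂ Q → ∀ i → ¬ (A i y ≈ 0#)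
        ∉∂⇒0≉A {y} y∈Q y∉∂Q i Aᵢy≈0 = y∉∂Q λ ε 0<ε →
          let δ , 0<δ , small = small-multiple y ε 0<ε in
          (y , (λ j → <-respˡ-≈ (sym (-‿inverseʳ (y j))) 0<ε , <-respˡ-≈ (sym (-‿inverseʳ (y j))) 0<ε) , y∈Q) ,
          (1# + δ) · y ,
          (λ j → <-respˡ-≈ (sym (trans (+-congˡ (-‿cong (trans (distribʳ _ _ _) (+-congʳ (*-identityˡ _)))))
                     (solve 2 (λ y z → y :- (y :+ z) := :- z) refl (y j) (δ * y j)))) (proj₂ (small j)) ,
                 <-respˡ-≈ (sym (trans (+-congʳ (trans (distribʳ _ _ _) (+-congʳ (*-identityˡ _))))
                     (solve 2 (λ y z → y :+ z :- y := z) refl (y j) (δ * y j)))) (proj₁ (small j))) ,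
          λ y′∈Q → Q⇒ y′∈Q i (<-resp-≈ (sym (outside δ)) -0#≈0#
            (0<y-x⇒x<y (<-respʳ-≈ (solve 1 (λ x → x := :- con 0ℤ :- (:- x)) refl (δ * ω i)) (*-pos 0<δ (0<ω i)))))
          where
          outside : ∀ δ → A i ((1# + δ) · y) ≈ - (δ * ω i)
          outside δ = begin
            ω i + l i ((1# + δ) · y)            ≈⟨ +-congˡ (linear-· (l-linear i) (1# + δ) y) ⟩
            ω i + (1# + δ) * l i y              ≈⟨ +-congˡ (trans (distribʳ _ _ _) (+-congʳ (*-identityˡ _))) ⟩
            ω i + (l i y + δ * l i y)
              ≈⟨ solve 3 (λ ω l δ → ω :+ (l :+ δ :* l) := (ω :+ l) :+ δ :* (ω :+ l) :- δ :* ω) refl (ω i) (l i y) δ ⟩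
            A i y + δ * A i y - δ * ω i         ≈⟨ +-congʳ (+-cong Aᵢy≈0 (trans (*-congˡ Aᵢy≈0) (zeroʳ δ))) ⟩
            0# + 0# - δ * ω i                   ≈⟨ trans (+-congʳ (+-identityˡ 0#)) (+-identityˡ _) ⟩
            - (δ * ω i)                         ∎

        -- All A i y = ω i (1 - ⟨y , q i⟩) are positive, so the integers ⟨y , q i⟩ are below 1 and
        -- hence at most 0. This makes every `l i y` nonnegative; as they sum to zero they all
        -- vanish, and they determine `y`.
        interior-lattice-point : ∀ {y} → y ∈ Q → y ∉ ∂ Q → y ∈ ℤ^ d → y ≋ 𝟎
        interior-lattice-point {y} y∈Q y∉∂Q (z , y≋z) j = begin
          y j                                        ≈⟨ Σl-vertex y j ⟨
          sum (λ i → l i y * ι (vertex i j))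
            ≈⟨ sum-zero (λ i → trans (*-congʳ (sum-zero-nonneg 0≤l (Σl≈0 y) i)) (zeroˡ _)) ⟩
          0#                                         ∎
          where
          A-integral : ∀ i → κ * b i + l i (ιᵛ (λ k → z k ℤ.+ w k)) ≈ A i y
          A-integral i = begin
            κ * b i + l i (ιᵛ (λ k → z k ℤ.+ w k))
              ≈⟨ +-congˡ (linear-cong (l-linear i) (λ k → trans (ι-+ (z k) (w k)) (+-congʳ (sym (y≋z k))))) ⟩
            κ * b i + l i (y ⊕ ιᵛ w)        ≈⟨ +-congˡ (linear-+ (l-linear i) y (ιᵛ w)) ⟩
            κ * b i + (l i y + l i (ιᵛ w))
              ≈⟨ solve 3 (λ B w y → B :+ (y :+ w) := B :+ w :+ y) refl (κ * b i) (l i (ιᵛ w)) (l i y) ⟩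
            ω i + l i y                     ∎
          0<A : ∀ i → 0# < A i y
          0<A i with trichotomous c (λ k → z k ℤ.+ w k) i
          ... | inj₁ A<0        = contradiction (<-respˡ-≈ (A-integral i) A<0) (Q⇒ y∈Q i)
          ... | inj₂ (inj₁ A≈0) = contradiction (trans (sym (A-integral i)) A≈0) (∉∂⇒0≉A y∈Q y∉∂Q i)
          ... | inj₂ (inj₂ 0<A) = <-respʳ-≈ (A-integral i) 0<A
          ⟨z,q⟩ : Fin n → ℤ
          ⟨z,q⟩ i = Determinant.sum (λ k → z k ℤ.* q i k)
          ι⟨z,q⟩ : ∀ i → ι (⟨z,q⟩ i) ≈ ⟨ y , ιᵛ (q i) ⟩
          ι⟨z,q⟩ i = trans (ι-⟨⟩ z (q i)) (sum-cong-≋ {d} (λ k → *-congʳ (sym (y≋z k))))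
          ⟨y,q⟩<1 : ∀ i → ⟨ y , ιᵛ (q i) ⟩ < 1#
          ⟨y,q⟩<1 i = 0<y-x⇒x<y (*-cancelˡ-< (ω i) (0<ω i) (<-resp-≈ (sym (zeroʳ _)) (begin
              A i y                                ≈⟨ solve 2 (λ ω l → ω :+ l := ω :- (:- l)) refl (ω i) (l i y) ⟩
              ω i - (- l i y)                      ≈⟨ +-cong (*-identityʳ _) (-‿cong (q-normal i y)) ⟨
              ω i * 1# - ω i * ⟨ y , ιᵛ (q i) ⟩    ≈⟨ solve 3 (λ ω u x → ω :* u :- ω :* x := ω :* (u :- x)) refl (ω i) 1# _ ⟩
              ω i * (1# - ⟨ y , ιᵛ (q i) ⟩)        ∎) (0<A i)))
          ⟨y,q⟩≤0 : ∀ i → ⟨ y , ιᵛ (q i) ⟩ ≤ 0#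
          ⟨y,q⟩≤0 i = ≤-resp-≈ (ι⟨z,q⟩ i) refl (ι-mono-≤ {⟨z,q⟩ i} {0ℤ} (ℤ.i<j⇒i≤pred[j]
            (ι-cancel-< {⟨z,q⟩ i} {1ℤ} (<-resp-≈ (sym (ι⟨z,q⟩ i)) (sym ι-1) (⟨y,q⟩<1 i)))))
          0≤l : ∀ i → 0# ≤ l i y
          0≤l i = ≤-resp-≈ refl (begin
              ω i * (0# - ⟨ y , ιᵛ (q i) ⟩)    ≈⟨ solve 2 (λ ω x → ω :* (con 0ℤ :- x) := :- (ω :* x)) refl (ω i) _ ⟩
              - (ω i * ⟨ y , ιᵛ (q i) ⟩)       ≈⟨ -‿cong (q-normal i y) ⟩
              - (- l i y)                      ≈⟨ -‿involutive _ ⟩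
              l i y                            ∎)
            (*-nonneg (<⇒≤ (0<ω i)) (x≤y⇒0≤y-x (⟨y,q⟩≤0 i)))

        origin∈Q : ∀ {y} → y ≋ 𝟎 → y ∈ Q
        origin∈Q y≋0 = Q⇐ λ i → ≤-resp-≈ refl (sym (A-origin i y≋0)) (<⇒≤ (0<ω i))

        ⟨⟩≤1⇒∈Q : ∀ {y} → (∀ i → ⟨ y , ιᵛ (q i) ⟩ ≤ 1#) → y ∈ Q
        ⟨⟩≤1⇒∈Q {y} ⟨y,q⟩≤1 = Q⇐ λ i → ≤-resp-≈ refl (begin
            ω i * (1# - ⟨ y , ιᵛ (q i) ⟩)        ≈⟨ solve 3 (λ ω u x → ω :* (u :- x) := ω :* u :- ω :* x) refl (ω i) 1# _ ⟩
            ω i * 1# - ω i * ⟨ y , ιᵛ (q i) ⟩    ≈⟨ +-cong (*-identityʳ _) (-‿cong (q-normal i y)) ⟩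
            ω i - (- l i y)                      ≈⟨ +-congˡ (-‿involutive _) ⟩
            A i y                                ∎)
          (*-nonneg (<⇒≤ (0<ω i)) (x≤y⇒0≤y-x (⟨y,q⟩≤1 i)))

        ∈Q⇒⟨⟩≤1 : ∀ {y} → y ∈ Q → ∀ i → ⟨ y , ιᵛ (q i) ⟩ ≤ 1#
        ∈Q⇒⟨⟩≤1 {y} y∈Q i = *-cancelˡ-≤ (ω i) (0<ω i) (0≤y-x⇒x≤y (≤-resp-≈ refl (begin
            A i y                                ≈⟨ solve 2 (λ ω l → ω :+ l := ω :- (:- l)) refl (ω i) (l i y) ⟩
            ω i - (- l i y)                      ≈⟨ +-cong (*-identityʳ _) (-‿cong (q-normal i y)) ⟨
            ω i * 1# - ω i * ⟨ y , ιᵛ (q i) ⟩    ∎) (Q⇒ y∈Q i)))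

        -- By `small-forms` all points close enough to the origin satisfy every inequality ⟨y , q i⟩
        -- ≤ 1, so none of them lies outside `Q`.
        origin∉∂Q : ∀ {y} → y ≋ 𝟎 → y ∉ ∂ Q
        origin∉∂Q {y} y≋0 y∈∂Q with small-forms (ιᵛ ∘ q)
        ... | ε , 0<ε , small with y∈∂Q ε 0<ε
        ...   | _ , x , near , x∉Q = x∉Q (⟨⟩≤1⇒∈Q λ i → <⇒≤ (small x (λ j →
                <-respˡ-≈ (trans (+-congˡ (trans (-‿cong (y≋0 j)) -0#≈0#)) (+-identityʳ _)) (proj₂ (near j)) ,
                <-respˡ-≈ (trans (+-congʳ (y≋0 j)) (+-identityˡ _)) (proj₁ (near j))) i))

        isFano : IsFano Q
        isFano = isLatticePolytope , isFullDimensional ,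
          (λ { ((y∈Q , y∉∂Q) , y∈ℤ) → interior-lattice-point y∈Q y∉∂Q y∈ℤ }) ,
          λ y≋0 → (origin∈Q y≋0 , origin∉∂Q y≋0) , const 0ℤ , y≋0

        -- The barycentric coordinates of the simplex with vertices `q`. Since `A k` vanishes at
        -- `V m` for k ≠ m and is κ at `V k`, the equation ⟨V m , y⟩ = 1 describes the facet
        -- opposite `q m`, and the factor κ⁻¹ ω m normalises the value at `q m` to 1.
        dual-coefficient : Point d → Vector Carrier n
        dual-coefficient y m = κ⁻¹ * (ω m * (1# - ⟨ ιᵛ (V m) , y ⟩))

        Σdual-coefficient≈1 : ∀ y → sum (dual-coefficient y) ≈ 1#
        Σdual-coefficient≈1 y = begin
          sum (dual-coefficient y)                          ≈⟨ sum-* {n} κ⁻¹ (λ m → ω m * (1# - ⟨ ιᵛ (V m) , y ⟩)) ⟩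
          κ⁻¹ * sum (λ m → ω m * (1# - ⟨ ιᵛ (V m) , y ⟩))
            ≈⟨ *-congˡ (sum-cong-≋ {n} (λ m → trans (solve 3 (λ ω u x → ω :* (u :- x) := ω :* u :- ω :* x) refl (ω m) 1# _)
                                                    (+-congʳ (*-identityʳ _)))) ⟩
          κ⁻¹ * sum (λ m → ω m - ω m * ⟨ ιᵛ (V m) , y ⟩)
            ≈⟨ *-congˡ (sum-sub ω (λ m → ω m * ⟨ ιᵛ (V m) , y ⟩)) ⟩
          κ⁻¹ * (sum ω - sum (λ m → ω m * ⟨ ιᵛ (V m) , y ⟩))
            ≈⟨ *-congˡ (+-cong Σω≈κ (-‿cong (trans (sym (linear-combination (⟨⟩-linearˡ y) ω (ιᵛ ∘ V)))
                                                   (linear-zero (⟨⟩-linearˡ y) ΣωV≈0)))) ⟩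
          κ⁻¹ * (κ - 0#)                                    ≈⟨ *-congˡ (trans (+-congˡ -0#≈0#) (+-identityʳ κ)) ⟩
          κ⁻¹ * κ                                           ≈⟨ κ⁻¹κ≈1 ⟩
          1#                                                ∎

        q-entry : ∀ m k → ω m * ι (q m k) ≈ - l m (e k)
        q-entry m k = trans (*-congˡ (sym (trans (⟨⟩-comm (e k) (ιᵛ (q m))) (sum-e (ιᵛ (q m)) k)))) (q-normal m (e k))

        dual-combination : ∀ y → y ≋ combination (dual-coefficient y) (ιᵛ ∘ q)
        dual-combination y k = sym (begin
          sum (λ m → dual-coefficient y m * ι (q m k))
            ≈⟨ sum-cong-≋ {n} term ⟩
          sum (λ m → κ⁻¹ * (l m (e k) * ⟨ ιᵛ (V m) , y ⟩ - l m (e k)))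
            ≈⟨ sum-* {n} κ⁻¹ (λ m → l m (e k) * ⟨ ιᵛ (V m) , y ⟩ - l m (e k)) ⟩
          κ⁻¹ * sum (λ m → l m (e k) * ⟨ ιᵛ (V m) , y ⟩ - l m (e k))
            ≈⟨ *-congˡ (sum-sub (λ m → l m (e k) * ⟨ ιᵛ (V m) , y ⟩) (λ m → l m (e k))) ⟩
          κ⁻¹ * (sum (λ m → l m (e k) * ⟨ ιᵛ (V m) , y ⟩) - sum (λ m → l m (e k)))
            ≈⟨ *-congˡ (+-cong (sym (linear-combination (⟨⟩-linearˡ y) (λ m → l m (e k)) (ιᵛ ∘ V)))
                               (-‿cong (Σl≈0 (e k)))) ⟩
          κ⁻¹ * (⟨ combination (λ m → l m (e k)) (ιᵛ ∘ V) , y ⟩ - 0#)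
            ≈⟨ *-congˡ (trans (+-congˡ -0#≈0#) (+-identityʳ _)) ⟩
          κ⁻¹ * ⟨ combination (λ m → l m (e k)) (ιᵛ ∘ V) , y ⟩
            ≈⟨ *-congˡ (trans (linear-cong (⟨⟩-linearˡ y) (ΣlV≈κ (e k))) (linear-· (⟨⟩-linearˡ y) κ (e k))) ⟩
          κ⁻¹ * (κ * ⟨ e k , y ⟩)    ≈⟨ κ⁻¹*[κ*x]≈x _ ⟩
          ⟨ e k , y ⟩                ≈⟨ trans (⟨⟩-comm (e k) y) (sum-e y k) ⟩
          y k                        ∎)
          where
          term : ∀ m → dual-coefficient y m * ι (q m k) ≈ κ⁻¹ * (l m (e k) * ⟨ ιᵛ (V m) , y ⟩ - l m (e k))
          term m = begin
            κ⁻¹ * (ω m * (1# - ⟨ ιᵛ (V m) , y ⟩)) * ι (q m k)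
              ≈⟨ solve 5 (λ κ ω u t q → κ :* (ω :* (u :- t)) :* q := κ :* ((ω :* q) :* u :- (ω :* q) :* t)) refl
                   κ⁻¹ (ω m) 1# ⟨ ιᵛ (V m) , y ⟩ (ι (q m k)) ⟩
            κ⁻¹ * (ω m * ι (q m k) * 1# - ω m * ι (q m k) * ⟨ ιᵛ (V m) , y ⟩)
              ≈⟨ *-congˡ (+-cong (trans (*-identityʳ _) (q-entry m k)) (-‿cong (*-congʳ (q-entry m k)))) ⟩
            κ⁻¹ * (- l m (e k) - - l m (e k) * ⟨ ιᵛ (V m) , y ⟩)
              ≈⟨ *-congˡ (solve 2 (λ l t → :- l :- (:- l) :* t := l :* t :- l) refl (l m (e k)) ⟨ ιᵛ (V m) , y ⟩) ⟩
            κ⁻¹ * (l m (e k) * ⟨ ιᵛ (V m) , y ⟩ - l m (e k))  ∎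

        V∈Q : ∀ m → ιᵛ (V m) ∈ Q
        V∈Q m = Q⇐ λ i → 0≤A-V i m

        dual-isLatticePolytope : IsLatticePolytope (Dual Q)
        dual-isLatticePolytope = n , q ,
          (λ {y} y∈Q* → dual-coefficient y ,
            -- Nonnegativity of the coordinates is the defining inequality of the dual, tested at
            -- the vertices `V m`.
            (λ m → *-nonneg (<⇒≤ 0<κ⁻¹) (*-nonneg (<⇒≤ (0<ω m)) (x≤y⇒0≤y-x (y∈Q* _ (V∈Q m))))) ,
            Σdual-coefficient≈1 y , dual-combination y) ,
          λ { (a , 0≤a , Σa≈1 , y≋) x x∈Q → ≤-resp-≈
                (sym (trans (linear-cong (⟨⟩-linearʳ x) y≋) (linear-combination (⟨⟩-linearʳ x) a (ιᵛ ∘ q))))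
                (trans (sum-cong-≋ {n} (λ m → *-identityʳ (a m))) Σa≈1)
                (sum-mono-≤ λ m → *-monoˡ-≤ (a m) (0≤a m) (∈Q⇒⟨⟩≤1 x∈Q m)) }

      dilation-reflexive : ∃[ Q ] UnimodularlyEquivalent (dilate c P) Q × IsReflexive {r ⊔ ℓ₁ ⊔ ℓ₂} {d} Q
      dilation-reflexive = Q ,
        (Determinant.e , (λ j → ℤ.- w j) , inj₁ (Determinant.det-e {d}) , (λ y∈Q → y∈Q) , (λ y∈Q → y∈Q)) ,
        isFano , dual-isLatticePolytope

    private
      unit-dilation : ∀ i y → Dilation.A 1 (const 0ℤ) i y ≈ b i + l i y
      unit-dilation i y = +-congʳ (trans
        (+-cong (trans (*-congʳ (+-identityʳ 1#)) (*-identityˡ _)) (linear-zero (l-linear i) (λ j → refl)))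
        (+-identityʳ _))

    sufficient : ∀ {c} → NonZero c → ∀ w → HasUnitNormals c w → IsGorensteinOfIndex c P
    sufficient {c} c≢0 w normals = c≢0 , isLatticePolytope , isFullDimensional ,
      Sufficiency.dilation-reflexive c {{c≢0}} w normals
      where
      open Dilation.Region 1 (const 0ℤ) {X = P}
        (λ p∈P i → ≤-resp-≈ refl (sym (unit-dilation i _)) (∈⇒0≤ p∈P i))
        (λ 0≤A → 0≤⇒∈ λ i → ≤-resp-≈ refl (unit-dilation i _) (0≤A i))

    -- From reflexivity to integral normals.

    private
      -- The adjoint of `f[ M ]` preserves integrality; it carries lattice points of the dual of `Q`
      -- back to integral normals of `c P - w`.
      pull-through : ∀ (M : Matrix d) x (p : Vector ℤ d) →
                     ⟨ f[ M ] x , ιᵛ p ⟩ ≈ ⟨ x , ιᵛ (λ k → Determinant.sum (λ j → M k j ℤ.* p j)) ⟩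
      pull-through M x p = trans (linear-combination (⟨⟩-linearˡ (ιᵛ p)) x (ιᵛ ∘ M))
        (sum-cong-≋ {d} (λ k → *-congˡ (sym (ι-⟨⟩ (M k) p))))

      f-cong : ∀ (M : Matrix d) {x y} → x ≋ y → f[ M ] x ≋ f[ M ] y
      f-cong M x≋y j = linear-cong (⟨⟩-linearˡ (λ i → ι (M i j))) x≋y

    module Necessity {c : ℕ} .{{_ : NonZero c}} {Q : Pred (Point d) (r ⊔ ℓ₁ ⊔ ℓ₂)}
      (U U⁻¹ : Matrix d) (UU⁻¹≡e : ∀ i k → Determinant.sum (λ j → U i j ℤ.* U⁻¹ j k) ≡ Determinant.e i k)
      (w′ : Vector ℤ d) (Q≐image : Q ≐ image (λ v → f[ U ] v ⊕ ιᵛ w′) (dilate c P)) (0∈Q : 𝟎 ∈ Q)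
      {m : ℕ} (u : Vector (Vector ℤ d) m) (Dual≐Conv : Dual Q ≐ Conv (Vec.map ιᵛ u)) where

      private
        f-inverse : ∀ x → f[ U⁻¹ ] (f[ U ] x) ≋ x
        f-inverse x k = trans (pull-through U x (λ j → U⁻¹ j k))
          (trans (sum-cong-≋ {d} (λ i → *-congˡ (trans (reflexive (cong ι (UU⁻¹≡e i k))) (trans (ι-e i k) (e-sym i k)))))
                 (sum-e x k))

        f-⊕ : ∀ x y j → f[ U ] (x ⊕ y) j ≈ f[ U ] x j + f[ U ] y j
        f-⊕ x y j = linear-+ (⟨⟩-linearˡ (λ i → ι (U i j))) x y

        x₀ : Point d
        x₀ = proj₁ (proj₁ Q≐image 0∈Q)

      -- The solution of vU + w′ = 0, written with `U⁻¹` so that it is integral by construction;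
      -- `x₀≋w` identifies it with the preimage of the origin in `c P`.
      w : Vector ℤ d
      w k = Determinant.sum (λ j → (ℤ.- w′ j) ℤ.* U⁻¹ j k)

      private
        f-x₀ : ∀ j → f[ U ] x₀ j ≈ ι (ℤ.- w′ j)
        f-x₀ j = begin
          f[ U ] x₀ j                             ≈⟨ solve 2 (λ x w → x := (x :+ w) :- w) refl _ _ ⟩
          f[ U ] x₀ j + ι (w′ j) - ι (w′ j)       ≈⟨ +-congʳ (proj₂ (proj₂ (proj₁ Q≐image 0∈Q)) j) ⟨
          0# - ι (w′ j)                           ≈⟨ +-identityˡ _ ⟩
          - ι (w′ j)                              ≈⟨ ι-neg (w′ j) ⟨
          ι (ℤ.- w′ j)                            ∎

        x₀≋w : x₀ ≋ ιᵛ w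
        x₀≋w k = trans (sym (f-inverse x₀ k)) (trans (f-cong U⁻¹ f-x₀ k)
          (sym (ι-⟨⟩ (λ j → ℤ.- w′ j) (λ j → U⁻¹ j k))))

        f-⊕w : ∀ y → f[ U ] (y ⊕ ιᵛ w) ⊕ ιᵛ w′ ≋ f[ U ] y
        f-⊕w y j = begin
          f[ U ] (y ⊕ ιᵛ w) j + ι (w′ j)            ≈⟨ +-congʳ (f-⊕ y (ιᵛ w) j) ⟩
          f[ U ] y j + f[ U ] (ιᵛ w) j + ι (w′ j)   ≈⟨ +-congʳ (+-congˡ (trans (sym (f-cong U x₀≋w j)) (f-x₀ j))) ⟩
          f[ U ] y j + ι (ℤ.- w′ j) + ι (w′ j)      ≈⟨ +-congʳ (+-congˡ (ι-neg (w′ j))) ⟩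
          f[ U ] y j - ι (w′ j) + ι (w′ j)          ≈⟨ solve 2 (λ x w → x :- w :+ w := x) refl _ _ ⟩
          f[ U ] y j                                ∎

      open Dilation c w

      private
        -- Together with `∈Q⇒f` this makes `Q` the image of `c P - w` under the linear map alone:
        -- the translation by `w′` is absorbed by `w`.
        f∈Q : ∀ {y} → (∀ i → 0# ≤ A i y) → f[ U ] y ∈ Q
        f∈Q {y} 0≤A = proj₂ Q≐image (y ⊕ ιᵛ w , dilate⁺ 0≤A , λ j → sym (f-⊕w y j))

        ∈Q⇒f : ∀ {x} → x ∈ Q → ∃[ y ] (∀ i → 0# ≤ A i y) × x ≋ f[ U ] y
        ∈Q⇒f {x} x∈Q with proj₁ Q≐image x∈Q
        ... | v , v∈cP , x≋ = y , dilate⁻ v∈cP v≋y+w , λ j →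
            trans (x≋ j) (trans (+-congʳ (f-cong U v≋y+w j)) (f-⊕w y j))
          where
          y : Point d
          y j = v j - ι (w j)
          v≋y+w : v ≋ y ⊕ ιᵛ w
          v≋y+w j = solve 2 (λ v w → v := v :- w :+ w) refl (v j) (ι (w j))

        0≤ω : ∀ i → 0# ≤ ω i
        0≤ω i = ≤-resp-≈ refl (A-origin i (λ _ → refl))
          (dilate⁻ (proj₁ (proj₂ (proj₁ Q≐image 0∈Q))) (λ j → trans (x₀≋w j) (sym (+-identityˡ _))) i)

        -- The form - s · l i, transported along `U⁻¹` to the coordinates of `Q`.
        functional : Fin n → Carrier → Point d
        functional i s j = - (s * l i (ιᵛ (U⁻¹ j)))

        ⟨f,functional⟩ : ∀ i s y → ⟨ f[ U ] y , functional i s ⟩ ≈ - (s * l i y)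
        ⟨f,functional⟩ i s y = begin
          sum (λ j → f[ U ] y j * - (s * l i (ιᵛ (U⁻¹ j))))
            ≈⟨ sum-cong-≋ {d} (λ j → solve 3 (λ f s l → f :* :- (s :* l) := :- s :* (f :* l)) refl
                                 (f[ U ] y j) s (l i (ιᵛ (U⁻¹ j)))) ⟩
          sum (λ j → - s * (f[ U ] y j * l i (ιᵛ (U⁻¹ j))))
            ≈⟨ sum-* (- s) (λ j → f[ U ] y j * l i (ιᵛ (U⁻¹ j))) ⟩
          - s * sum (λ j → f[ U ] y j * l i (ιᵛ (U⁻¹ j)))
            ≈⟨ *-congˡ (linear-combination (l-linear i) (f[ U ] y) (ιᵛ ∘ U⁻¹)) ⟨
          - s * l i (f[ U⁻¹ ] (f[ U ] y))    ≈⟨ *-congˡ (linear-cong (l-linear i) (f-inverse y)) ⟩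
          - s * l i y                        ≈⟨ -‿distribˡ-* s (l i y) ⟨
          - (s * l i y)                      ∎

        pairing : Point d → Vector Carrier m
        pairing y j = ⟨ f[ U ] y , ιᵛ (u j) ⟩

        -- On `c P - w` the form is - s · l i = s · ω i - s · A i ≤ s · ω i ≤ 1. Hence it belongs to
        -- the dual polytope and is a convex combination of the generators `u`.
        functional-decomposition : ∀ i s → 0# ≤ s → s * ω i ≤ 1# →
          ∃[ a ] (∀ j → 0# ≤ a j) × sum a ≈ 1# × (∀ y → sum (λ j → a j * pairing y j) ≈ - (s * l i y))
        functional-decomposition i s 0≤s sω≤1 = a , 0≤a , Σa≈1 , λ y → begin
          sum (λ j → a j * pairing y j)
            ≈⟨ linear-combination (⟨⟩-linearʳ (f[ U ] y)) a (ιᵛ ∘ u) ⟨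
          ⟨ f[ U ] y , combination a (ιᵛ ∘ u) ⟩
            ≈⟨ linear-cong (⟨⟩-linearʳ (f[ U ] y)) functional≋ ⟨
          ⟨ f[ U ] y , functional i s ⟩         ≈⟨ ⟨f,functional⟩ i s y ⟩
          - (s * l i y)                         ∎
          where
          functional≤1 : ∀ {x} → (∃[ y ] (∀ i → 0# ≤ A i y) × x ≋ f[ U ] y) → ⟨ x , functional i s ⟩ ≤ 1#
          functional≤1 {x} (y , 0≤A , x≋fy) = ≤-trans (≤-resp-≈
              (begin
                s * ω i - s * A i y                ≈⟨ solve 3 (λ s ω l → s :* ω :- s :* (ω :+ l) := :- (s :* l)) refl s (ω i) (l i y) ⟩
                - (s * l i y)                      ≈⟨ ⟨f,functional⟩ i s y ⟨
                ⟨ f[ U ] y , functional i s ⟩      ≈⟨ linear-cong (⟨⟩-linearˡ (functional i s)) x≋fy ⟨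
                ⟨ x , functional i s ⟩             ∎)
              refl
              (0≤y-x⇒x≤y {s * ω i - s * A i y} {s * ω i} (≤-resp-≈ refl
                (solve 2 (λ p q → q := p :- (p :- q)) refl (s * ω i) (s * A i y)) (*-nonneg 0≤s (0≤A i)))))
            sω≤1
          convex : functional i s ∈ Conv (Vec.map ιᵛ u)
          convex = proj₁ Dual≐Conv (λ x x∈Q → functional≤1 (∈Q⇒f x∈Q))
          a : Vector Carrier m
          a = proj₁ convex
          0≤a : ∀ j → 0# ≤ a j
          0≤a = proj₁ (proj₂ convex)
          Σa≈1 : sum a ≈ 1#
          Σa≈1 = proj₁ (proj₂ (proj₂ convex))
          functional≋ : functional i s ≋ combination a (ιᵛ ∘ u)
          functional≋ = proj₂ (proj₂ (proj₂ convex))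

        pairing≤1 : ∀ {y} → (∀ i → 0# ≤ A i y) → ∀ j → pairing y j ≤ 1#
        pairing≤1 0≤A j = proj₂ Dual≐Conv
          -- The weights `e j` exhibit the generator `u j` itself as a point of the hull, hence of
          -- the dual.
          (e j , 0≤e j , trans (sum-cong-≋ {m} (λ i → sym (*-identityˡ (e j i)))) (sum-e (const 1#) j) ,
           λ k → sym (trans (sum-cong-≋ {m} (λ i → *-comm (e j i) (ι (u i k)))) (sum-e (λ i → ι (u i k)) j)))
          _ (f∈Q 0≤A)

        -- If ω i vanished, the dual polytope would contain a ray.
        ω≉0 : ∀ i → ¬ (ω i ≈ 0#)
        ω≉0 i ω≈0 =
          -- The scale M κ⁻¹ gives the form the value -M at `V i`, where `l i` would be κ. Every
          -- generator pairs with that point to more than -M, so no convex combination of them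
          -- reaches -M.
          let M , 0<M , M-bound     = bounded (λ j → - pairing (ιᵛ (V i)) j)
              a , 0≤a , Σa≈1 , Σa≈l = functional-decomposition i (M * κ⁻¹) (<⇒≤ (*-pos 0<M 0<κ⁻¹))
                                        (≤-resp-≈ (sym (trans (*-congˡ ω≈0) (zeroʳ _))) refl (<⇒≤ 0<1))
              0<M+pairing : ∀ j → 0# < M + pairing (ιᵛ (V i)) j
              0<M+pairing j = <-respʳ-≈ (+-congˡ (-‿involutive _)) (x<y⇒0<y-x (M-bound j))
              j , 0<aⱼ = positive-summand a (<-respʳ-≈ (sym Σa≈1) 0<1)
          in <-irrefl (sym (begin
               sum (λ j → a j * (M + pairing (ιᵛ (V i)) j))
                 ≈⟨ sum-cong-≋ {m} (λ j → trans (distribˡ _ _ _) (+-congʳ (*-comm _ _))) ⟩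
               sum (λ j → M * a j + a j * pairing (ιᵛ (V i)) j)
                 ≈⟨ ∑-distrib-+ (λ j → M * a j) (λ j → a j * pairing (ιᵛ (V i)) j) ⟩
               sum (λ j → M * a j) + sum (λ j → a j * pairing (ιᵛ (V i)) j)
                 ≈⟨ +-cong (trans (sum-* M a) (trans (*-congˡ Σa≈1) (*-identityʳ M))) (Σa≈l (ιᵛ (V i))) ⟩
               M - M * κ⁻¹ * l i (ιᵛ (V i))
                 ≈⟨ +-congˡ (-‿cong (trans (*-congˡ l≈κ) (trans (*-assoc _ _ _) (trans (*-congˡ κ⁻¹κ≈1) (*-identityʳ M))))) ⟩
               M - M  ≈⟨ -‿inverseʳ M ⟩
               0#     ∎))
             (sum-positive (λ j → *-nonneg (0≤a j) (<⇒≤ (0<M+pairing j))) j (*-pos 0<aⱼ (0<M+pairing j)))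
          where
          l≈κ : l i (ιᵛ (V i)) ≈ κ
          l≈κ = begin
            l i (ιᵛ (V i))         ≈⟨ +-identityˡ _ ⟨
            0# + l i (ιᵛ (V i))    ≈⟨ +-congʳ ω≈0 ⟨
            A i (ιᵛ (V i))         ≈⟨ A-V i i ⟩
            κ * e i i              ≈⟨ trans (*-congˡ (e-diagonal i)) (*-identityʳ κ) ⟩
            κ                      ∎

        0<ω : ∀ i → 0# < ω i
        0<ω i with trichotomous c w i
        ... | inj₁ ω<0        = contradiction ω<0 (0≤ω i)
        ... | inj₂ (inj₁ ω≈0) = contradiction ω≈0 (ω≉0 i)
        ... | inj₂ (inj₂ 0<ω) = 0<ω

        -- A dual vertex of positive weight in - l i / ω i attains the value 1 on
        -- the whole i-th facet, hence equals - l i / ω i.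
        unit-normal : ∀ i → ∃[ q ] ∀ y → ω i * ⟨ y , ιᵛ q ⟩ ≈ - l i y
        unit-normal i = q , λ y → *-cancelˡ-≈ κ 0<κ (begin
            κ * (ω i * ⟨ y , ιᵛ q ⟩)
              ≈⟨ solve 3 (λ κ ω t → κ :* (ω :* t) := ω :* (κ :* t)) refl κ (ω i) ⟨ y , ιᵛ q ⟩ ⟩
            ω i * (κ * ⟨ y , ιᵛ q ⟩)
              ≈⟨ *-congˡ (trans (linear-cong (⟨⟩-linearˡ (ιᵛ q)) (ΣlV≈κ y)) (linear-· (⟨⟩-linearˡ (ιᵛ q)) κ y)) ⟨
            ω i * ⟨ combination (λ k → l k y) (ιᵛ ∘ V) , ιᵛ q ⟩
              ≈⟨ *-congˡ (linear-combination (⟨⟩-linearˡ (ιᵛ q)) (λ k → l k y) (ιᵛ ∘ V)) ⟩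
            ω i * sum (λ k → l k y * γ k)
              -- Subtracting the vanishing sum of the `l k y` cancels each term with γ k = 1; only
              -- the vertex `V i` opposite the facet remains.
              ≈⟨ *-congˡ (trans (+-congˡ (trans (-‿cong (Σl≈0 y)) -0#≈0#)) (+-identityʳ _)) ⟨
            ω i * (sum (λ k → l k y * γ k) - sum (λ k → l k y))
              ≈⟨ *-congˡ (sum-sub (λ k → l k y * γ k) (λ k → l k y)) ⟨
            ω i * sum (λ k → l k y * γ k - l k y)
              ≈⟨ *-congˡ (sum-single (λ k → l k y * γ k - l k y) i (λ k i≢k → begin
                   l k y * γ k - l k y   ≈⟨ +-congʳ (trans (*-congˡ (γ≈1 k i≢k)) (*-identityʳ _)) ⟩
                   l k y - l k y         ≈⟨ -‿inverseʳ _ ⟩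
                   0#                    ∎)) ⟩
            ω i * (l i y * γ i - l i y)
              ≈⟨ solve 3 (λ ω l γ → ω :* (l :* γ :- l) := l :* (ω :* γ :- ω)) refl (ω i) (l i y) (γ i) ⟩
            l i y * (ω i * γ i - ω i)    ≈⟨ *-congˡ ωγ ⟩
            l i y * - κ                  ≈⟨ solve 2 (λ l κ → l :* :- κ := κ :* :- l) refl (l i y) κ ⟩
            κ * - l i y                  ∎)
          where
          ρ : Carrier
          ρ = proj₁ (reciprocal (0<ω i))
          ρω≈1 : ρ * ω i ≈ 1#
          ρω≈1 = proj₂ (proj₂ (reciprocal (0<ω i)))
          decomposition = functional-decomposition i ρ (<⇒≤ (proj₁ (proj₂ (reciprocal (0<ω i))))) (≤-reflexive ρω≈1)
          a : Vector Carrier m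
          a = proj₁ decomposition
          0≤a : ∀ j → 0# ≤ a j
          0≤a = proj₁ (proj₂ decomposition)
          Σa≈1 : sum a ≈ 1#
          Σa≈1 = proj₁ (proj₂ (proj₂ decomposition))
          Σa≈l : ∀ y → sum (λ j → a j * pairing y j) ≈ - (ρ * l i y)
          Σa≈l = proj₂ (proj₂ (proj₂ decomposition))
          support : ∃[ j ] 0# < a j
          support = positive-summand a (<-respʳ-≈ (sym Σa≈1) 0<1)
          j : Fin m
          j = proj₁ support
          q : Vector ℤ d
          q k = Determinant.sum (λ h → U k h ℤ.* u j h)
          γ : Vector Carrier n
          γ k = ⟨ ιᵛ (V k) , ιᵛ q ⟩
          γ≈1 : ∀ k → i ≢ k → γ k ≈ 1#
          γ≈1 k i≢k = begin
            γ k             ≈⟨ pull-through U (ιᵛ (V k)) (u j) ⟨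
            g j             ≈⟨ solve 2 (λ u g → g := u :- (u :- g)) refl 1# (g j) ⟩
            1# - (1# - g j)
              ≈⟨ +-congˡ (-‿cong (*-cancelˡ-≈ (a j) (proj₂ support) (trans (sum-zero-nonneg 0≤term Σterm≈0 j) (sym (zeroʳ _))))) ⟩
            1# - 0#         ≈⟨ trans (+-congˡ -0#≈0#) (+-identityʳ 1#) ⟩
            1#              ∎
            where
            g : Vector Carrier m
            g = pairing (ιᵛ (V k))
            0≤term : ∀ h → 0# ≤ a h * (1# - g h)
            0≤term h = *-nonneg (0≤a h) (x≤y⇒0≤y-x (pairing≤1 (λ i → 0≤A-V i k) h))
            l≈-ω : l i (ιᵛ (V k)) ≈ - ω i
            l≈-ω = begin
              l i (ιᵛ (V k))             ≈⟨ solve 2 (λ ω l → l := (ω :+ l) :- ω) refl (ω i) (l i (ιᵛ (V k))) ⟩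
              A i (ιᵛ (V k)) - ω i       ≈⟨ +-congʳ (trans (A-V i k) (trans (*-congˡ (e-off-diagonal i≢k)) (zeroʳ κ))) ⟩
              0# - ω i                   ≈⟨ +-identityˡ _ ⟩
              - ω i                      ∎
            -- At a vertex of the i-th facet - ρ · l i has the value 1, the largest that any
            -- generator can take there. So the weighted defects of the generators add up to zero.
            Σterm≈0 : sum (λ h → a h * (1# - g h)) ≈ 0#
            Σterm≈0 = begin
              sum (λ h → a h * (1# - g h))
                ≈⟨ sum-cong-≋ {m} (λ h → trans (solve 3 (λ a u g → a :* (u :- g) := a :* u :- a :* g) refl (a h) 1# (g h))
                                               (+-congʳ (*-identityʳ (a h)))) ⟩
              sum (λ h → a h - a h * g h)           ≈⟨ sum-sub a (λ h → a h * g h) ⟩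
              sum a - sum (λ h → a h * g h)         ≈⟨ +-cong Σa≈1 (-‿cong (Σa≈l (ιᵛ (V k)))) ⟩
              1# - (- (ρ * l i (ιᵛ (V k))))         ≈⟨ +-congˡ (-‿cong (-‿cong (*-congˡ l≈-ω))) ⟩
              1# - (- (ρ * - ω i))                  ≈⟨ solve 3 (λ u ρ ω → u :- (:- (ρ :* :- ω)) := u :- ρ :* ω) refl 1# ρ (ω i) ⟩
              1# - ρ * ω i                          ≈⟨ +-congˡ (-‿cong ρω≈1) ⟩
              1# - 1#                               ≈⟨ -‿inverseʳ 1# ⟩
              0#                                    ∎
          -- The combination of the `V k` with weights `ω k` is the origin, and every γ k with k ≠ i
          -- is 1; this forces the remaining value.
          ωγ : ω i * γ i - ω i ≈ - κ
          ωγ = begin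
            ω i * γ i - ω i
              ≈⟨ sum-single (λ k → ω k * γ k - ω k) i (λ k i≢k →
                   trans (+-congʳ (trans (*-congˡ (γ≈1 k i≢k)) (*-identityʳ _))) (-‿inverseʳ _)) ⟨
            sum (λ k → ω k * γ k - ω k)             ≈⟨ sum-sub (λ k → ω k * γ k) ω ⟩
            sum (λ k → ω k * γ k) - sum ω
              ≈⟨ +-cong (trans (sym (linear-combination (⟨⟩-linearˡ (ιᵛ q)) ω (ιᵛ ∘ V)))
                               (linear-zero (⟨⟩-linearˡ (ιᵛ q)) ΣωV≈0)) (-‿cong Σω≈κ) ⟩
            0# - κ                                  ≈⟨ +-identityˡ _ ⟩
            - κ                                     ∎

      hasUnitNormals : HasUnitNormals c w
      hasUnitNormals = 0<ω , unit-normal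

    abstract
      necessary : ∀ {c} → IsGorensteinOfIndex c P → ∃[ w ] HasUnitNormals c w
      necessary (c≢0 , _ , _ , Q , (U , w′ , det≡±1 , Q≐image) , (_ , _ , interior) , m , u , Dual≐Conv) =
        let U⁻¹ , UU⁻¹≡e = Determinant.unimodular-inverse U det≡±1
            open Necessity {{c≢0}} U U⁻¹ UU⁻¹≡e w′ Q≐image (proj₁ (proj₁ (proj₂ interior (λ _ → refl)))) u Dual≐Conv
        in w , hasUnitNormals

-- Integer paths with unit steps, their shears and their gluing.

module Chains where

  -- The 2 × 2 determinant of two points of the path.
  cross : ℕ⁺ × ℤ → ℕ⁺ × ℤ → ℤ
  cross (σ , a) (σ′ , a′) = + value σ ℤ.* a′ ℤ.- + value σ′ ℤ.* a

  Unit : ℕ⁺ × ℤ → ℕ⁺ × ℤ → Set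
  Unit p@(σ , _) p′@(σ′ , _) = 0ℤ ℤ.< cross p p′ × cross p p′ ∣ + value σ × cross p p′ ∣ + value σ′

  path : ∀ {d} → Vector ℕ⁺ d → Vector ℤ d → ℤ → List.List (ℕ⁺ × ℤ)
  path s w c = Vec.toList (Vec.zip s w) List.++ (1⁺ , c) List.∷ List.[]

  UnitChain : ∀ {d} → Vector ℕ⁺ d → Vector ℤ d → ℕ → Set
  UnitChain s w c = Linked Unit ((1⁺ , 0ℤ) List.∷ path s w (+ c))

  -- With starting point (1,0), final height c gives the numbers hᵢ, while final height 0 gives the
  -- scaled linear parts of the facet functionals.
  crosses : ∀ {d} → ℕ⁺ × ℤ → Vector ℕ⁺ d → Vector ℤ d → ℤ → Fin (suc d) → ℤ
  crosses {zero}  p s w c zero    = cross p (1⁺ , c)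
  crosses {suc d} p s w c zero    = cross p (s zero , w zero)
  crosses {suc d} p s w c (suc i) = crosses (s zero , w zero) (s ∘ suc) (w ∘ suc) c i

  Unit⇒cross∣ : ∀ p p′ → Unit p p′ → ∀ x x′ → cross p p′ ∣ cross (proj₁ p , x) (proj₁ p′ , x′)
  Unit⇒cross∣ _ _ (_ , h∣σ , h∣σ′) x x′ = ∣m∣n⇒∣m-n (∣m⇒∣m*n x′ h∣σ) (∣m⇒∣m*n x h∣σ′)

  -- The starting height `x` of the test path is arbitrary because, one step later, it is a
  -- coordinate of `y`.
  linked⇒crosses : ∀ {d} σ a (s : Vector ℕ⁺ d) w c → Linked Unit ((σ , a) List.∷ path s w c) →
    ∀ i → 0ℤ ℤ.< crosses (σ , a) s w c i ×
          (∀ x y → crosses (σ , a) s w c i ∣ crosses (σ , x) s y 0ℤ i)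
  linked⇒crosses {zero}  σ a s w c (R ∷ᴸ _) zero    = proj₁ R , λ x y → Unit⇒cross∣ (σ , a) (1⁺ , c) R x 0ℤ
  linked⇒crosses {suc d} σ a s w c (R ∷ᴸ _) zero    = proj₁ R , λ x y → Unit⇒cross∣ (σ , a) (s zero , w zero) R x (y zero)
  linked⇒crosses {suc d} σ a s w c (_ ∷ᴸ L) (suc i) =
    let 0<h , h∣ = linked⇒crosses (s zero) (w zero) (s ∘ suc) (w ∘ suc) c L i
    in 0<h , λ x y → h∣ (y zero) (y ∘ suc)

  private
    cross-10 : ∀ p q → p ℤ.* 1ℤ ℤ.- q ℤ.* 0ℤ ≡ p
    cross-10 = solve-∀

    cross-01 : ∀ p q → p ℤ.* 0ℤ ℤ.- q ℤ.* -1ℤ ≡ q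
    cross-01 = solve-∀

    1∣ : ∀ z → 1ℤ ∣ z
    1∣ z = divides z (≡.sym (ℤ.*-identityʳ z))

  -- The test heights (0, 1) and (-1, 0) read off the two coefficients of a step. At the last step
  -- the final height is fixed at 0, and (-1, 0) gives h ∣ 1, which settles both divisibilities.
  crosses⇒linked : ∀ {d} σ a (s : Vector ℕ⁺ d) w c → (∀ i → 0ℤ ℤ.< crosses (σ , a) s w c i) →
    (∀ i x y → crosses (σ , a) s w c i ∣ crosses (σ , x) s y 0ℤ i) →
    Linked Unit ((σ , a) List.∷ path s w c)
  crosses⇒linked {zero} σ a s w c 0<h h∣ = (0<h zero , ∣-trans h∣1 (1∣ _) , h∣1) ∷ᴸ [-]
    where
    h∣1 : crosses (σ , a) s w c zero ∣ 1ℤ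
    h∣1 = ≡.subst (crosses (σ , a) s w c zero ∣_) (cross-01 (+ value σ) 1ℤ) (h∣ zero -1ℤ (λ ()))
  crosses⇒linked {suc d} σ a s w c 0<h h∣ =
    (0<h zero ,
     ≡.subst (crosses (σ , a) s w c zero ∣_) (cross-10 (+ value σ) (+ value (s zero))) (h∣ zero 0ℤ (const 1ℤ)) ,
     ≡.subst (crosses (σ , a) s w c zero ∣_) (cross-01 (+ value σ) (+ value (s zero))) (h∣ zero -1ℤ (const 0ℤ))) ∷ᴸ
    crosses⇒linked (s zero) (w zero) (s ∘ suc) (w ∘ suc) c (0<h ∘ suc) (λ i x y → h∣ (suc i) 0ℤ (x ∷ y))

  -- The starting height is now fixed at 0, so the first step is tested at its far end only; height
  -- 1 there gives h ∣ 1. For d = 0 that far end would be fixed as well, and nothing would bound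
  -- `c`.
  crosses⇒unitChain : ∀ {d} .{{_ : NonZero d}} (s : Vector ℕ⁺ d) w c →
    (∀ i → 0ℤ ℤ.< crosses (1⁺ , 0ℤ) s w (+ c) i) →
    (∀ i y → crosses (1⁺ , 0ℤ) s w (+ c) i ∣ crosses (1⁺ , 0ℤ) s y 0ℤ i) → UnitChain s w c
  crosses⇒unitChain {suc d} s w c 0<h h∣ =
    (0<h zero , h∣1 , ∣-trans h∣1 (1∣ _)) ∷ᴸ
    crosses⇒linked (s zero) (w zero) (s ∘ suc) (w ∘ suc) (+ c) (0<h ∘ suc) (λ i x y → h∣ (suc i) (x ∷ y))
    where
    h∣1 : crosses (1⁺ , 0ℤ) s w (+ c) zero ∣ 1ℤ
    h∣1 = ≡.subst (crosses (1⁺ , 0ℤ) s w (+ c) zero ∣_) (cross-10 1ℤ (+ value (s zero))) (h∣ zero (const 1ℤ))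

  shear : ℕ → ℕ⁺ × ℤ → ℕ⁺ × ℤ
  shear k (σ , a) = σ , a ℤ.+ + k ℤ.* + value σ

  cross-shear : ∀ k p p′ → cross (shear k p) (shear k p′) ≡ cross p p′
  cross-shear k (σ , a) (σ′ , a′) = lemma (+ k) (+ value σ) a (+ value σ′) a′
    where
    lemma : ∀ k σ a σ′ a′ → σ ℤ.* (a′ ℤ.+ k ℤ.* σ′) ℤ.- σ′ ℤ.* (a ℤ.+ k ℤ.* σ) ≡ σ ℤ.* a′ ℤ.- σ′ ℤ.* a
    lemma = solve-∀

  Unit-shear : ∀ k p p′ → Unit p p′ → Unit (shear k p) (shear k p′)
  Unit-shear k p p′ = ≡.subst
    (λ h → 0ℤ ℤ.< h × h ∣ + value (proj₁ p) × h ∣ + value (proj₁ p′)) (≡.sym (cross-shear k p p′))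

  Linked-glue : ∀ {a ℓ} {X : Set a} {R : X → X → Set ℓ} {x y zs} xs →
                Linked R (x List.∷ xs List.++ y List.∷ List.[]) → Linked R (y List.∷ zs) →
                Linked R (x List.∷ xs List.++ y List.∷ zs)
  Linked-glue List.[]         (Rxy ∷ᴸ _) Ls = Rxy ∷ᴸ Ls
  Linked-glue (_ List.∷ xs)   (Rxy ∷ᴸ L) Ls = Rxy ∷ᴸ Linked-glue xs L Ls

  toList-++ : ∀ {a} {X : Set a} {m n} (xs : Vector X m) (ys : Vector X n) →
              Vec.toList (xs ++ ys) ≡ Vec.toList xs List.++ Vec.toList ys
  toList-++ {m = zero}  xs ys = ≡.refl
  toList-++ {m = suc m} xs ys = cong (xs zero List.∷_)
    (≡.trans (List.tabulate-cong (λ i → tail-++ i)) (toList-++ (xs ∘ suc) ys))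
    where
    tail-++ : ∀ i → (xs ++ ys) (suc i) ≡ ((xs ∘ suc) ++ ys) i
    tail-++ i with splitAt m i
    ... | inj₁ _ = ≡.refl
    ... | inj₂ _ = ≡.refl

  zip-++ : ∀ {a b} {X : Set a} {Y : Set b} {m n} (xs : Vector X m) (ys : Vector X n) (us : Vector Y m) (vs : Vector Y n) i →
           Vec.zip (xs ++ ys) (us ++ vs) i ≡ (Vec.zip xs us ++ Vec.zip ys vs) i
  zip-++ {m = m} xs ys us vs i with splitAt m i
  ... | inj₁ _ = ≡.refl
  ... | inj₂ _ = ≡.refl

  unitChain-++ : ∀ {d e} (s : Vector ℕ⁺ d) (t : Vector ℕ⁺ e) k l →
                 ∃[ w ] UnitChain s w k → ∃[ v ] UnitChain t v l → ∃[ u ] UnitChain (s ++ (1⁺ ∷ t)) u (k ℕ.+ l)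
  -- The height `+ k` belongs to the inserted entry 1: the point (1,k) is both the end of the path
  -- of `s` and the sheared start of the path of `t`.
  unitChain-++ s t k l (w , chainₛ) (v , chainₜ) = w ++ (+ k ∷ v′) ,
    ≡.subst (λ ps → Linked Unit ((1⁺ , 0ℤ) List.∷ ps)) (≡.sym path-++)
      (Linked-glue (Vec.toList (Vec.zip s w)) chainₛ
        (≡.subst (Linked Unit) sheared (Linked.map⁺ (Linked.map (λ {p} {p′} → Unit-shear k p p′) chainₜ))))
    where
    v′ : Vector ℤ _
    v′ j = v j ℤ.+ + k ℤ.* + value (t j)
    sheared : List.map (shear k) ((1⁺ , 0ℤ) List.∷ path t v (+ l)) ≡ (1⁺ , + k) List.∷ path t v′ (+ (k ℕ.+ l))
    sheared = cong₂ List._∷_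
      (cong (1⁺ ,_) (≡.trans (ℤ.+-identityˡ _) (ℤ.*-identityʳ (+ k))))
      (≡.trans (List.map-++ (shear k) (Vec.toList (Vec.zip t v)) _)
        (cong₂ List._++_ (List.map-tabulate (Vec.zip t v) (shear k))
          (cong (λ z → (1⁺ , z) List.∷ List.[]) (≡.trans (cong (ℤ._+_ (+ l)) (ℤ.*-identityʳ (+ k)))
            (≡.trans (≡.sym (ℤ.pos-+ l k)) (cong +_ (ℕ.+-comm l k)))))))
    path-++ : path (s ++ (1⁺ ∷ t)) (w ++ (+ k ∷ v′)) (+ (k ℕ.+ l)) ≡
              Vec.toList (Vec.zip s w) List.++ (1⁺ , + k) List.∷ path t v′ (+ (k ℕ.+ l))
    path-++ = ≡.trans
      (cong (List._++ (1⁺ , + (k ℕ.+ l)) List.∷ List.[])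
        (≡.trans (List.tabulate-cong (zip-++ s (1⁺ ∷ t) w (+ k ∷ v′)))
                 (toList-++ (Vec.zip s w) (Vec.zip (1⁺ ∷ t) (+ k ∷ v′)))))
      (List.++-assoc (Vec.toList (Vec.zip s w)) _ _)

-- Lecture hall simplices and the translation of normals into chains.

module LectureHalls {r ℓ₁ ℓ₂ : Level} (ℝ : Reals r ℓ₁ ℓ₂) where
  open RealAlgebra ℝ
  open Simplices ℝ
  open Chains

  -- For a = 0 and `z` the ratios xⱼ/sⱼ, the value c = 1 gives the barycentric coordinates of the
  -- lecture hall simplex, c = 0 their linear parts, and c = κ the facet functionals of its dilation
  -- by κ.
  gap : ∀ {d} → Carrier → Vector Carrier d → Carrier → Fin (suc d) → Carrier
  gap {zero}  a z c zero    = c - a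
  gap {suc d} a z c zero    = z zero - a
  gap {suc d} a z c (suc i) = gap (z zero) (z ∘ suc) c i

  gap-linear : ∀ {d} α β {a a₁ a₂ c c₁ c₂} {z z₁ z₂ : Vector Carrier d} → a ≈ α * a₁ + β * a₂ →
               (∀ j → z j ≈ α * z₁ j + β * z₂ j) → c ≈ α * c₁ + β * c₂ →
               ∀ i → gap a z c i ≈ α * gap a₁ z₁ c₁ i + β * gap a₂ z₂ c₂ i
  gap-linear {zero} α β {a₁ = a₁} {a₂} {c₁ = c₁} {c₂} a≈ z≈ c≈ zero = trans (+-cong c≈ (-‿cong a≈))
    (solve 6 (λ α β x₁ x₂ a₁ a₂ → (α :* x₁ :+ β :* x₂) :- (α :* a₁ :+ β :* a₂) :=
                                  α :* (x₁ :- a₁) :+ β :* (x₂ :- a₂)) refl α β c₁ c₂ a₁ a₂)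
  gap-linear {suc d} α β {a₁ = a₁} {a₂} {z₁ = z₁} {z₂} a≈ z≈ c≈ zero = trans (+-cong (z≈ zero) (-‿cong a≈))
    (solve 6 (λ α β x₁ x₂ a₁ a₂ → (α :* x₁ :+ β :* x₂) :- (α :* a₁ :+ β :* a₂) :=
                                  α :* (x₁ :- a₁) :+ β :* (x₂ :- a₂)) refl α β (z₁ zero) (z₂ zero) a₁ a₂)
  gap-linear {suc d} α β a≈ z≈ c≈ (suc i) = gap-linear α β (z≈ zero) (z≈ ∘ suc) c≈ i

  sum-gap : ∀ {d} a (z : Vector Carrier d) c → sum (gap a z c) ≈ c - a
  sum-gap {zero}  a z c = +-identityʳ _
  sum-gap {suc d} a z c = trans (+-congˡ (sum-gap (z zero) (z ∘ suc) c))
    (solve 3 (λ a z c → (z :- a) :+ (c :- z) := c :- a) refl a (z zero) c)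

  linked⇒gap≥0 : ∀ {d} a (z : Vector Carrier d) c →
                 Linked _≤_ (a List.∷ Vec.toList z List.++ c List.∷ List.[]) → ∀ i → 0# ≤ gap a z c i
  linked⇒gap≥0 {zero}  a z c (a≤c ∷ᴸ _) zero    = x≤y⇒0≤y-x a≤c
  linked⇒gap≥0 {suc d} a z c (a≤z ∷ᴸ _) zero    = x≤y⇒0≤y-x a≤z
  linked⇒gap≥0 {suc d} a z c (_ ∷ᴸ L)   (suc i) = linked⇒gap≥0 (z zero) (z ∘ suc) c L i

  gap≥0⇒linked : ∀ {d} a (z : Vector Carrier d) c → (∀ i → 0# ≤ gap a z c i) →
                 Linked _≤_ (a List.∷ Vec.toList z List.++ c List.∷ List.[])
  gap≥0⇒linked {zero}  a z c 0≤gap = 0≤y-x⇒x≤y (0≤gap zero) ∷ᴸ [-]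
  gap≥0⇒linked {suc d} a z c 0≤gap =
    0≤y-x⇒x≤y (0≤gap zero) ∷ᴸ gap≥0⇒linked (z zero) (z ∘ suc) c (0≤gap ∘ suc)

  ⟦_⟧ : ℕ⁺ → Carrier
  ⟦ s ⟧ = ι (+ value s)

  0<⟦_⟧ : ∀ s → 0# < ⟦ s ⟧
  0<⟦ n , [ n≢0 ] ⟧ = 0<n×1 n {{n≢0}}

  [x/s]*s≈x : ∀ x s → (x / s) * ⟦ s ⟧ ≈ x
  [x/s]*s≈x x s@(n , [ n≢0 ]) = trans (*-assoc x _ _) (trans (*-congˡ inverse) (*-identityʳ x))
    where
    invertible = #⇒invertible (inj₂ (0<n×1 n {{n≢0}}))
    inverse : proj₁ invertible * ⟦ s ⟧ ≈ 1#
    inverse = trans (*-congˡ (sym (trans (+-congˡ -0#≈0#) (+-identityʳ _)))) (proj₁ (proj₂ invertible))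

  /-linear : ∀ s α β {x x₁ x₂} → x ≈ α * x₁ + β * x₂ → x / s ≈ α * (x₁ / s) + β * (x₂ / s)
  /-linear s α β {x} {x₁} {x₂} x≈ = *-cancelˡ-≈ ⟦ s ⟧ 0<⟦ s ⟧ (begin
    ⟦ s ⟧ * (x / s)        ≈⟨ trans (*-comm _ _) ([x/s]*s≈x x s) ⟩
    x                      ≈⟨ x≈ ⟩
    α * x₁ + β * x₂        ≈⟨ +-cong (*-congˡ ([x/s]*s≈x x₁ s)) (*-congˡ ([x/s]*s≈x x₂ s)) ⟨
    α * ((x₁ / s) * ⟦ s ⟧) + β * ((x₂ / s) * ⟦ s ⟧)
      ≈⟨ solve 5 (λ α β x y s → α :* (x :* s) :+ β :* (y :* s) := s :* (α :* x :+ β :* y)) refl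
           α β (x₁ / s) (x₂ / s) ⟦ s ⟧ ⟩
    ⟦ s ⟧ * (α * (x₁ / s) + β * (x₂ / s))  ∎)

  -- Vertex m is (0, ..., 0, sₘ₊₁, ..., s_d), with m zeros.
  corner : ∀ {d} → Vector ℕ⁺ d → Fin (suc d) → Vector ℤ d
  corner         s zero    j       = + value (s j)
  corner {suc d} s (suc i) zero    = 0ℤ
  corner {suc d} s (suc i) (suc j) = corner (s ∘ suc) i j

  -- Coordinate j of corner i is `s j` for i ≤ j and 0 otherwise, so the sum of gaps telescopes up
  -- to `z j`.
  sum-gap-corner : ∀ {d} a z c (s : Vector ℕ⁺ d) j →
                   sum (λ i → gap a z c i * ι (corner s i j)) ≈ (z j - a) * ⟦ s j ⟧
  sum-gap-corner {suc d} a z c s zero = trans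
    (+-congˡ (sum-zero {suc d} (λ i → zeroʳ (gap (z zero) (z ∘ suc) c i)))) (+-identityʳ _)
  sum-gap-corner {suc d} a z c s (suc j) = trans
    (+-congˡ (sum-gap-corner (z zero) (z ∘ suc) c (s ∘ suc) j))
    (solve 4 (λ a y z s → (y :- a) :* s :+ (z :- y) :* s := (z :- a) :* s) refl a (z zero) (z (suc j)) ⟦ s (suc j) ⟧)

  gap-constant : ∀ {d} a (z : Vector Carrier d) c → (∀ j → z j ≈ c) → a ≈ c → ∀ i → gap a z c i ≈ 0#
  gap-constant {zero}  a z c z≈c a≈c zero    = trans (+-congˡ (-‿cong a≈c)) (-‿inverseʳ c)
  gap-constant {suc d} a z c z≈c a≈c zero    = trans (+-cong (z≈c zero) (-‿cong a≈c)) (-‿inverseʳ c)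
  gap-constant {suc d} a z c z≈c a≈c (suc i) = gap-constant (z zero) (z ∘ suc) c (z≈c ∘ suc) (z≈c zero) i

  -- The ratios of corner m are m zeros followed by ones, so the only nonzero difference is the jump
  -- at position m.
  gap-corner : ∀ {d} a z (s : Vector ℕ⁺ d) m → a ≈ 0# → (∀ j → z j * ⟦ s j ⟧ ≈ ι (corner s m j)) →
               ∀ i → gap a z 1# i ≈ e i m
  gap-corner {zero}  a z s zero a≈0 z≈ zero = trans (+-congˡ (trans (-‿cong a≈0) -0#≈0#)) (+-identityʳ 1#)
  gap-corner {suc d} a z s zero a≈0 z≈ i = first i
    where
    z≈1 : ∀ j → z j ≈ 1#
    z≈1 j = *-cancelˡ-≈ ⟦ s j ⟧ 0<⟦ s j ⟧ (trans (*-comm _ _) (trans (z≈ j) (sym (*-identityʳ _))))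
    first : ∀ i → gap a z 1# i ≈ e i zero
    first zero    = trans (+-cong (z≈1 zero) (trans (-‿cong a≈0) -0#≈0#)) (+-identityʳ 1#)
    first (suc i) = gap-constant (z zero) (z ∘ suc) 1# (z≈1 ∘ suc) (z≈1 zero) i
  gap-corner {suc d} a z s (suc m) a≈0 z≈ i = rest i
    where
    z₀≈0 : z zero ≈ 0#
    z₀≈0 = *-cancelˡ-≈ ⟦ s zero ⟧ 0<⟦ s zero ⟧ (trans (*-comm _ _) (trans (z≈ zero) (sym (zeroʳ _))))
    rest : ∀ i → gap a z 1# i ≈ e i (suc m)
    rest zero    = trans (+-cong z₀≈0 (trans (-‿cong a≈0) -0#≈0#)) (+-identityʳ 0#)
    rest (suc i) = gap-corner (z zero) (z ∘ suc) (s ∘ suc) m z₀≈0 (z≈ ∘ suc) i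

  -- The product σᵢσᵢ₊₁, a common denominator for the i-th gap at lattice points.
  scale : ∀ {d} → ℕ⁺ → Vector ℕ⁺ d → Fin (suc d) → Carrier
  scale {zero}  σ s zero    = ⟦ σ ⟧ * ⟦ 1⁺ ⟧
  scale {suc d} σ s zero    = ⟦ σ ⟧ * ⟦ s zero ⟧
  scale {suc d} σ s (suc i) = scale (s zero) (s ∘ suc) i

  0<scale : ∀ {d} σ (s : Vector ℕ⁺ d) i → 0# < scale σ s i
  0<scale {zero}  σ s zero    = *-pos 0<⟦ σ ⟧ 0<⟦ 1⁺ ⟧
  0<scale {suc d} σ s zero    = *-pos 0<⟦ σ ⟧ 0<⟦ s zero ⟧
  0<scale {suc d} σ s (suc i) = 0<scale (s zero) (s ∘ suc) i

  scale*gap : ∀ {d} σ (s : Vector ℕ⁺ d) {α a z w γ c} → α * ⟦ σ ⟧ ≈ ι a → (∀ j → z j * ⟦ s j ⟧ ≈ ι (w j)) →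
              γ ≈ ι c → ∀ i → scale σ s i * gap α z γ i ≈ ι (crosses (σ , a) s w c i)
  -- `⟦ 1⁺ ⟧` equals 1 only up to `≈`. Treating γ as a ratio with denominator 1 makes the last step
  -- of the path an instance of `step`.
  scale*gap σ s α≈ z≈ γ≈ = go σ s α≈ z≈ (trans (*-congˡ ι-1) (trans (*-identityʳ _) γ≈))
    where
    step : ∀ σ σ′ {α α′ a a′} → α * ⟦ σ ⟧ ≈ ι a → α′ * ⟦ σ′ ⟧ ≈ ι a′ →
           ⟦ σ ⟧ * ⟦ σ′ ⟧ * (α′ - α) ≈ ι (cross (σ , a) (σ′ , a′))
    step σ σ′ {α} {α′} {a} {a′} α≈ α′≈ = begin
      ⟦ σ ⟧ * ⟦ σ′ ⟧ * (α′ - α)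
        ≈⟨ solve 4 (λ s t x y → s :* t :* (y :- x) := s :* (y :* t) :- t :* (x :* s)) refl ⟦ σ ⟧ ⟦ σ′ ⟧ α α′ ⟩
      ⟦ σ ⟧ * (α′ * ⟦ σ′ ⟧) - ⟦ σ′ ⟧ * (α * ⟦ σ ⟧)
        ≈⟨ +-cong (*-congˡ α′≈) (-‿cong (*-congˡ α≈)) ⟩
      ⟦ σ ⟧ * ι a′ - ⟦ σ′ ⟧ * ι a
        ≈⟨ +-cong (ι-* (+ value σ) a′) (trans (ι-neg (+ value σ′ ℤ.* a)) (-‿cong (ι-* (+ value σ′) a))) ⟨
      ι (+ value σ ℤ.* a′) + ι (ℤ.- (+ value σ′ ℤ.* a))
        ≈⟨ ι-+ (+ value σ ℤ.* a′) (ℤ.- (+ value σ′ ℤ.* a)) ⟨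
      ι (cross (σ , a) (σ′ , a′))  ∎
    go : ∀ {d} σ (s : Vector ℕ⁺ d) {α a z w γ c} → α * ⟦ σ ⟧ ≈ ι a → (∀ j → z j * ⟦ s j ⟧ ≈ ι (w j)) →
         γ * ⟦ 1⁺ ⟧ ≈ ι c → ∀ i → scale σ s i * gap α z γ i ≈ ι (crosses (σ , a) s w c i)
    go {zero}  σ s α≈ z≈ γ≈ zero    = step σ 1⁺ α≈ γ≈
    go {suc d} σ s α≈ z≈ γ≈ zero    = step σ (s zero) α≈ (z≈ zero)
    go {suc d} σ s α≈ z≈ γ≈ (suc i) = go (s zero) (s ∘ suc) (z≈ zero) (z≈ ∘ suc) γ≈ i

  module _ {d : ℕ} (s : Vector ℕ⁺ d) where

    private
      constants : Vector Carrier (suc d)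
      constants = gap 0# 𝟎 1#

      forms : Fin (suc d) → Point d → Carrier
      forms i x = gap 0# (Vec.zipWith _/_ x s) 0# i

      homogenised : ∀ κ x i → κ * constants i + forms i x ≈ gap 0# (Vec.zipWith _/_ x s) κ i
      homogenised κ x i = sym (trans
        -- The sequence (0, x/s, κ) is κ · (0, 𝟎, 1) + 1 · (0, x/s, 0).
        (gap-linear κ 1# (sym (trans (+-cong (zeroʳ _) (zeroʳ _)) (+-identityˡ 0#)))
          (λ j → sym (trans (+-cong (zeroʳ _) (*-identityˡ _)) (+-identityˡ _)))
          (sym (trans (+-cong (*-identityʳ _) (zeroʳ _)) (+-identityʳ _))) i)
        (+-congˡ (*-identityˡ _)))

      affine : ∀ x i → constants i + forms i x ≈ gap 0# (Vec.zipWith _/_ x s) 1# i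
      affine x i = trans (+-congʳ (sym (*-identityˡ _))) (homogenised 1# x i)

      scale*homogenised : ∀ c z i → scale 1⁺ s i * ((c ×ₙ 1#) * constants i + forms i (ιᵛ z)) ≈
                                    ι (crosses (1⁺ , 0ℤ) s z (+ c) i)
      scale*homogenised c z i = trans (*-congˡ (homogenised (c ×ₙ 1#) (ιᵛ z) i))
        (scale*gap 1⁺ s (zeroˡ _) (λ j → [x/s]*s≈x (ι (z j)) (s j)) refl i)

      scale*forms : ∀ z i → scale 1⁺ s i * forms i (ιᵛ z) ≈ ι (crosses (1⁺ , 0ℤ) s z 0ℤ i)
      scale*forms z = scale*gap 1⁺ s (zeroˡ _) (λ j → [x/s]*s≈x (ι (z j)) (s j)) refl

      forms-linear : ∀ i → IsLinear (forms i)
      forms-linear i a b x≈ = gap-linear a b zero≈ (λ j → /-linear (s j) a b (x≈ j)) zero≈ i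
        where
        zero≈ : 0# ≈ a * 0# + b * 0#
        zero≈ = sym (trans (+-cong (zeroʳ a) (zeroʳ b)) (+-identityˡ 0#))

      -- The positive factor `scale` turns the value into an integer, whose sign is decidable.
      trichotomous : ∀ c z i → let B = (c ×ₙ 1#) * constants i + forms i (ιᵛ z) in B < 0# ⊎ B ≈ 0# ⊎ 0# < B
      trichotomous c z i with ℤ.<-cmp (crosses (1⁺ , 0ℤ) s z (+ c) i) 0ℤ
      ... | tri< h<0 _ _ = inj₁ (*-cancelˡ-< (scale 1⁺ s i) (0<scale 1⁺ s i)
              (<-resp-≈ (sym (scale*homogenised c z i)) (sym (zeroʳ _)) (ι-mono-< h<0)))
      ... | tri≈ _ h≡0 _ = inj₂ (inj₁ (*-cancelˡ-≈ (scale 1⁺ s i) (0<scale 1⁺ s i)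
              (trans (scale*homogenised c z i) (trans (reflexive (cong ι h≡0)) (sym (zeroʳ _))))))
      ... | tri> _ _ 0<h = inj₂ (inj₂ (*-cancelˡ-< (scale 1⁺ s i) (0<scale 1⁺ s i)
              (<-resp-≈ (sym (zeroʳ _)) (sym (scale*homogenised c z i)) (ι-mono-< 0<h))))

    simplex : LatticeSimplex (suc d) (LectureHall s)
    simplex = record
      { vertex       = corner s
      ; b            = constants
      ; l            = forms
      ; l-linear     = forms-linear
      ; Σb≈1         = trans (sum-gap {d} 0# 𝟎 1#) (trans (+-congˡ -0#≈0#) (+-identityʳ 1#))
      ; Σl≈0         = λ x → trans (sum-gap 0# (Vec.zipWith _/_ x s) 0#) (-‿inverseʳ 0#)
      ; Σb-vertex    = λ j → trans (sum-gap-corner 0# 𝟎 1# s j) (trans (*-congʳ (-‿inverseʳ 0#)) (zeroˡ _))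
      ; Σl-vertex    = λ x j → trans (sum-gap-corner 0# (Vec.zipWith _/_ x s) 0# s j)
                         (trans (*-congʳ (trans (+-congˡ -0#≈0#) (+-identityʳ _))) ([x/s]*s≈x (x j) (s j)))
      ; l-vertex     = λ i m → trans (affine (ιᵛ (corner s m)) i)
                         (gap-corner 0# (Vec.zipWith _/_ (ιᵛ (corner s m)) s) s m refl
                           (λ j → [x/s]*s≈x (ι (corner s m j)) (s j)) i)
      ; ∈⇒0≤         = λ {x} x∈P i → ≤-resp-≈ refl (sym (affine x i)) (linked⇒gap≥0 0# _ 1# x∈P i)
      ; 0≤⇒∈         = λ {x} 0≤ → gap≥0⇒linked 0# _ 1# (λ i → ≤-resp-≈ refl (affine x i) (0≤ i))
      ; trichotomous = trichotomous
      }

    open Criterion simplex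

    -- Multiplied by `scale`, the equation ω i ⟨y , q i⟩ = - l i y says that the cross of `y` at
    -- final height 0 is - ⟨y , q i⟩ times hᵢ.
    unitNormals⇒unitChain : .{{_ : NonZero d}} → ∀ {c w} → HasUnitNormals c w → UnitChain s w c
    unitNormals⇒unitChain {c} {w} (0<ω , normal) = crosses⇒unitChain s w c
      (λ i → ι-cancel-< (<-respʳ-≈ (scale*homogenised c w i) (*-pos (0<scale 1⁺ s i) (0<ω i))))
      λ i y → divides (ℤ.- ⟨y,q⟩ i y) (ι-injective (begin
        ι (crosses (1⁺ , 0ℤ) s y 0ℤ i)               ≈⟨ scale*forms y i ⟨
        scale 1⁺ s i * forms i (ιᵛ y)                ≈⟨ *-congˡ (-‿involutive _) ⟨
        scale 1⁺ s i * - - forms i (ιᵛ y)            ≈⟨ *-congˡ (-‿cong (proj₂ (normal i) (ιᵛ y))) ⟨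
        scale 1⁺ s i * - (ω i * ⟨ ιᵛ y , ιᵛ (q i) ⟩)
          ≈⟨ solve 3 (λ s ω t → s :* :- (ω :* t) := :- t :* (s :* ω)) refl (scale 1⁺ s i) (ω i) _ ⟩
        - ⟨ ιᵛ y , ιᵛ (q i) ⟩ * (scale 1⁺ s i * ω i)
          ≈⟨ *-cong (trans (ι-neg (⟨y,q⟩ i y)) (-‿cong (ι-⟨⟩ y (q i)))) (sym (scale*homogenised c w i)) ⟨
        ι (ℤ.- ⟨y,q⟩ i y) * ι (crosses (1⁺ , 0ℤ) s w (+ c) i)
          ≈⟨ ι-* (ℤ.- ⟨y,q⟩ i y) (crosses (1⁺ , 0ℤ) s w (+ c) i) ⟨
        ι (ℤ.- ⟨y,q⟩ i y ℤ.* crosses (1⁺ , 0ℤ) s w (+ c) i)  ∎))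
      where
      ω : Vector Carrier (suc d)
      ω i = (c ×ₙ 1#) * constants i + forms i (ιᵛ w)
      q : Fin (suc d) → Vector ℤ d
      q i = proj₁ (normal i)
      ⟨y,q⟩ : Fin (suc d) → Vector ℤ d → ℤ
      ⟨y,q⟩ i y = Determinant.sum (λ j → y j ℤ.* q i j)

    -- The quotients by hᵢ at the basis vectors are, up to sign, the entries of the normal;
    -- linearity extends the equation from the basis to all `y`.
    unitChain⇒unitNormals : ∀ {c w} → UnitChain s w c → HasUnitNormals c w
    unitChain⇒unitNormals {c} {w} chain =
      (λ i → *-cancelˡ-< (scale 1⁺ s i) (0<scale 1⁺ s i) (<-resp-≈ (sym (zeroʳ _)) (sym (scale*homogenised c w i))
               (ι-mono-< (proj₁ (linked⇒crosses 1⁺ 0ℤ s w (+ c) chain i))))) ,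
      λ i → q i , λ y → begin
        ω i * ⟨ y , ιᵛ (q i) ⟩                     ≈⟨ *-distribˡ-sum (ω i) (λ j → y j * ι (q i j)) ⟩
        sum (λ j → ω i * (y j * ι (q i j)))
          ≈⟨ sum-cong-≋ {d} (λ j → trans
               (solve 3 (λ ω y q → ω :* (y :* q) := y :* (ω :* q)) refl (ω i) (y j) (ι (q i j)))
               (*-congˡ (entry i j))) ⟩
        sum (λ j → y j * - forms i (e j))
          ≈⟨ sum-cong-≋ {d} (λ j → sym (-‿distribʳ-* (y j) (forms i (e j)))) ⟩
        sum (λ j → - (y j * forms i (e j)))        ≈⟨ sum-neg (λ j → y j * forms i (e j)) ⟩
        - sum (λ j → y j * forms i (e j))          ≈⟨ -‿cong (linear-expansion (forms-linear i) y) ⟨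
        - forms i y                                ∎
      where
      ω : Vector Carrier (suc d)
      ω i = (c ×ₙ 1#) * constants i + forms i (ιᵛ w)
      h : Fin (suc d) → ℤ
      h = crosses (1⁺ , 0ℤ) s w (+ c)
      h∣ : ∀ i j → h i ∣ crosses (1⁺ , 0ℤ) s (Determinant.e j) 0ℤ i
      h∣ i j = proj₂ (linked⇒crosses 1⁺ 0ℤ s w (+ c) chain i) 0ℤ (Determinant.e j)
      q : Fin (suc d) → Vector ℤ d
      q i j = ℤ.- quotient (h∣ i j)
      entry : ∀ i j → ω i * ι (q i j) ≈ - forms i (e j)
      entry i j = *-cancelˡ-≈ (scale 1⁺ s i) (0<scale 1⁺ s i) (begin
        scale 1⁺ s i * (ω i * ι (q i j))           ≈⟨ *-assoc _ _ _ ⟨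
        scale 1⁺ s i * ω i * ι (q i j)             ≈⟨ *-cong (scale*homogenised c w i) (ι-neg (quotient (h∣ i j))) ⟩
        ι (h i) * - ι (quotient (h∣ i j))          ≈⟨ solve 2 (λ h q → h :* :- q := :- (q :* h)) refl _ _ ⟩
        - (ι (quotient (h∣ i j)) * ι (h i))        ≈⟨ -‿cong (ι-* (quotient (h∣ i j)) (h i)) ⟨
        - ι (quotient (h∣ i j) ℤ.* h i)            ≈⟨ -‿cong (reflexive (cong ι (_∣_.equality (h∣ i j)))) ⟨
        - ι (crosses (1⁺ , 0ℤ) s (Determinant.e j) 0ℤ i)
          ≈⟨ -‿cong (scale*forms (Determinant.e j) i) ⟨
        - (scale 1⁺ s i * forms i (ιᵛ (Determinant.e j)))
          ≈⟨ -‿distribʳ-* _ _ ⟩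
        scale 1⁺ s i * - forms i (ιᵛ (Determinant.e j))
          ≈⟨ *-congˡ (-‿cong (linear-cong (forms-linear i) (ι-e j))) ⟩
        scale 1⁺ s i * - forms i (e j)             ∎)

    gorenstein⇒unitChain : .{{_ : NonZero d}} → ∀ {c} → IsGorensteinOfIndex c (LectureHall s) → ∃[ w ] UnitChain s w c
    gorenstein⇒unitChain {c} gorenstein = chain (necessary gorenstein)
      where
      chain : ∃[ w ] HasUnitNormals c w → ∃[ w ] UnitChain s w c
      chain (w , normals) = w , unitNormals⇒unitChain {w = w} normals

    unitChain⇒gorenstein : ∀ {c} → NonZero c → ∃[ w ] UnitChain s w c → IsGorensteinOfIndex c (LectureHall s)
    unitChain⇒gorenstein c≢0 (w , chain) = sufficient c≢0 w (unitChain⇒unitNormals chain)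

private
  +-nonZero : ∀ {k} l → NonZero k → NonZero (k ℕ.+ l)
  +-nonZero {suc _} l _ = _

open import Data.Nat.Base using (_+_)

theorem4p3 : ∀ {r ℓ₁ ℓ₂} (ℝ : Reals r ℓ₁ ℓ₂) → let open Polytopes ℝ in
    ∀ {d e} .{{_ : NonZero d}} .{{_ : NonZero e}}
    (s : Vector ℕ⁺ d) (t : Vector ℕ⁺ e) (k l : ℕ) →
    IsGorensteinOfIndex k (LectureHall s) →
    IsGorensteinOfIndex l (LectureHall t) →
    IsGorensteinOfIndex (k + l) (LectureHall (s ++ (1⁺ ∷ t)))
theorem4p3 ℝ s t k l gorensteinₛ gorensteinₜ =
  LectureHalls.unitChain⇒gorenstein ℝ (s ++ (1⁺ ∷ t)) (+-nonZero l (proj₁ gorensteinₛ))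
    (Chains.unitChain-++ s t k l (LectureHalls.gorenstein⇒unitChain ℝ s gorensteinₛ)
                                 (LectureHalls.gorenstein⇒unitChain ℝ t gorensteinₜ))
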